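{- Let $\widehat{O}$ be the collection of all words $(b_0,b_1,\dots,b_n)$ of integers ($n\geq 0$) such that, with $V_0=\infty$ and $V_{k+1}=[b_0,b_1,\dots,b_k]$ for $k=0,1,\dots,n$, one has $V_{n+1}=0$ and $V_0,V_1,\dots,V_{n+1}$ are pairwise distinct. Then $\widehat{O}$ is an exclusion set over $\mathbb{Z}$, and $\mathrm{Ex}(\widehat{O})\subsetneq \mathrm{Ex}(O)$ for any finite exclusion set $O$ over $\mathbb{Z}$.
   Context: Continued fractions. For a sequence of integers $b_0,b_1,\dots$, the (negative) integer continued fraction $[b_0,b_1,\dots]$ is $b_0-\cfrac{1}{b_1-\cfrac{1}{b_2-\cdots}}$. Put $A_0=1$, $B_0=0$, $A_1=b_0$, $B_1=1$ and $A_{n+1}=b_nA_n-A_{n-1}$, $B_{n+1}=b_nB_n-B_{n-1}$ for $n\geq 1$. The convergents are $A_n/B_n\in\widehat{\mathbb{C}}=\mathbb{C}\cup\{\infty\}$, and the value of the finite continued fraction $[b_0,\dots,b_n]$ is $A_{n+1}/B_{n+1}$. An infinite continued fraction converges if its sequence of convergents converges in the topological space $\widehat{\mathbb{C}}$ (the Riemann sphere; convergence to $\infty$ is permitted), and otherwise it diverges. Words. A word is a nonempty finite sequence of integers $(x_1,\dots,x_n)$; a word of length one is written $x_1$. A word $x$ is a substring of $[b_0,b_1,\dots]$, or of a word $(b_0,\dots,b_m)$, if $x=(b_r,b_{r+1},\dots,b_s)$ for some $0\leq r\leq s$ (contiguous). A (possibly infinite) set of words $X$ is without redundancy if no element of $X$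 is a substring of another element of $X$. Over $\mathbb{Z}$, define $\overline{X}=X\cup(-X)\cup\{0\}$, where $-X$ is obtained by negating all entries of each word and $0$ denotes the word of length one with entry $0$. $X$ is symmetric if $X=\overline{X}$. Exclusion sets. For a symmetric set $X$, $\mathrm{Ex}(X)$ is the set of all infinite integer continued fractions $[b_0,b_1,\dots]$ for which every tail $[b_n,b_{n+1},\dots]$ contains a substring from $X$. A symmetric set $X$ without redundancy is an exclusion set over $\mathbb{Z}$ if $\mathrm{Ex}(X)$ contains every divergent integer continued fraction. An exclusion set is finite if it has finite cardinality. -}

module Defs where

open import Data.Integer.Base using (ℤ; +_; +[1+_]; -[1+_]; 0ℤ; 1ℤ)
import Data.Integer.Base as ℤ
open import Data.List.Base using (List; []; _∷_; applyUpTo)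
open import Data.List.NonEmpty.Base using (List⁺; [_]; toList; length; map)
import Data.List.Membership.Propositional as List
open import Data.List.Relation.Binary.Infix.Heterogeneous using (Infix)
open import Data.Nat.Base as ℕ using (ℕ; zero; suc)
open import Data.Product.Base using (∃; _×_; _,_)
open import Data.Rational.Base as ℚ using (ℚ; 0ℚ; 1ℚ)
import Data.Rational.Properties as ℚ
open import Data.Sum.Base using (_⊎_; inj₁; inj₂)
open import Data.Unit.Base using (⊤)
open import Data.Empty using (⊥)
open import Level using (0ℓ)
open import Relation.Binary.Definitions using (tri<; tri≈; tri>)
open import Relation.Binary.PropositionalEquality
  using (_≡_; _≢_; refl; subst)
open import Relation.Nullary using (¬_)
open import Relation.Unary using (Pred; _∈_; _∪_; _⊆_; _≐_; ｛_｝)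

------------------------------------------------------------------------
-- The Riemann sphere

-- Two-sided Dedekind cuts: L q means q < x and U q means x < q.
record ℝ : Set₁ where
  field
    L U       : Pred ℚ 0ℓ
    inhabited : ∃ L × ∃ U
    L-rounded : ∀ {q} → L q → ∃ λ r → q ℚ.< r × L r
    L-closed  : ∀ {q r} → q ℚ.< r → L r → L q
    U-rounded : ∀ {q} → U q → ∃ λ r → r ℚ.< q × U r
    U-closed  : ∀ {q r} → r ℚ.< q → U r → U q
    disjoint  : ∀ q → ¬ (L q × U q)
    located   : ∀ {q r} → q ℚ.< r → L q ⊎ U r

fromℚ : ℚ → ℝ
fromℚ x = record
  { L         = ℚ._< x
  ; U         = x ℚ.<_
  ; inhabited = (x ℚ.- 1ℚ , x-1<x) , (x ℚ.+ 1ℚ , x<x+1)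
  ; L-rounded = λ q<x → ℚ.<-dense q<x
  ; L-closed  = ℚ.<-trans
  ; U-rounded = λ x<q → let r , x<r , r<q = ℚ.<-dense x<q in r , r<q , x<r
  ; U-closed  = λ r<q x<r → ℚ.<-trans x<r r<q
  ; disjoint  = λ q (q<x , x<q) → ℚ.<-asym q<x x<q
  ; located   = located
  }
  where
  x-1<x : x ℚ.- 1ℚ ℚ.< x
  x-1<x = subst (x ℚ.- 1ℚ ℚ.<_) (ℚ.+-identityʳ x)
            (ℚ.+-monoʳ-< x (ℚ.negative⁻¹ (ℚ.- 1ℚ)))

  x<x+1 : x ℚ.< x ℚ.+ 1ℚ
  x<x+1 = subst (ℚ._< x ℚ.+ 1ℚ) (ℚ.+-identityʳ x)
            (ℚ.+-monoʳ-< x (ℚ.positive⁻¹ 1ℚ))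

  located : ∀ {q r} → q ℚ.< r → q ℚ.< x ⊎ x ℚ.< r
  located {q} q<r with ℚ.<-cmp q x
  ... | tri< q<x _ _    = inj₁ q<x
  ... | tri≈ _ refl _   = inj₂ q<r
  ... | tri> _ _ x<q    = inj₂ (ℚ.<-trans x<q q<r)

data Ĉ : Set₁ where
  ∞    : Ĉ
  _+i_ : (x y : ℝ) → Ĉ

-- A base of the topology of Ĉ = ℂ ∪ {∞}, the one-point compactification
-- of ℂ = ℝ²: the open rectangles (p , q) × (r , s) of ℂ, and the
-- complements in Ĉ of the closed squares [- M , M] × [- M , M].
data BasicOpen : Set where
  rectangle : (p q r s : ℚ) → BasicOpen
  exterior  : (M : ℚ) → BasicOpen

infix 4 _∈ᵒ_

_∈ᵒ_ : Ĉ → BasicOpen → Set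
∞        ∈ᵒ rectangle p q r s = ⊥
(x +i y) ∈ᵒ rectangle p q r s =
  (ℝ.L x p × ℝ.U x q) × (ℝ.L y r × ℝ.U y s)
∞        ∈ᵒ exterior M        = ⊤
(x +i y) ∈ᵒ exterior M        =
  (ℝ.U x (ℚ.- M) ⊎ ℝ.L x M) ⊎ (ℝ.U y (ℚ.- M) ⊎ ℝ.L y M)

_⟶_ : (ℕ → Ĉ) → Ĉ → Set
s ⟶ z = ∀ U → z ∈ᵒ U → ∃ λ N → ∀ n → N ℕ.≤ n → s n ∈ᵒ U

data ℚ∞ : Set where
  ∞   : ℚ∞
  fin : ℚ → ℚ∞

ι : ℚ∞ → Ĉ
ι ∞       = ∞
ι (fin q) = fromℚ q +i fromℚ 0ℚ

-- 0 ÷ 0 gets the junk value ∞; it does not arise for the convergents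
-- below, since A₍ₙ₊₁₎ Bₙ - Aₙ B₍ₙ₊₁₎ = -1.
_÷_ : ℤ → ℤ → ℚ∞
a ÷ (+ zero)   = ∞
a ÷ +[1+ n ]   = fin (a ℚ./ suc n)
a ÷ (-[1+ n ]) = fin ((ℤ.- a) ℚ./ suc n)

------------------------------------------------------------------------
-- Integer continued fractions

-- b stands for [b 0 , b 1 , …].
CF : Set
CF = ℕ → ℤ

A B : CF → ℕ → ℤ
A b zero          = 1ℤ
A b (suc zero)    = b 0
A b (suc (suc n)) = b (suc n) ℤ.* A b (suc n) ℤ.- A b n

B b zero          = 0ℤ
B b (suc zero)    = 1ℤ
B b (suc (suc n)) = b (suc n) ℤ.* B b (suc n) ℤ.- B b n

convergent : CF → ℕ → ℚ∞
convergent b n = A b n ÷ B b n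

Converges : Pred CF _
Converges b = ∃ λ z → (λ n → ι (convergent b n)) ⟶ z

Diverges : Pred CF _
Diverges b = ¬ Converges b

tail : ℕ → CF → CF
tail n b i = b (n ℕ.+ i)

------------------------------------------------------------------------
-- Words

Word : Set
Word = List⁺ ℤ

_SubstringOf_ : Word → Word → Set
x SubstringOf w = Infix _≡_ (toList x) (toList w)

_SubstringOfCF_ : Word → CF → Set
x SubstringOfCF b =
  ∃ λ r → toList x ≡ applyUpTo (λ i → b (r ℕ.+ i)) (length x)

negate : Word → Word
negate = map (λ b → ℤ.- b)

neg : Pred Word 0ℓ → Pred Word 0ℓ
neg X w = ∃ λ x → x ∈ X × w ≡ negate x

closure : Pred Word 0ℓ → Pred Word 0ℓ
closure X = X ∪ neg X ∪ ｛ [ 0ℤ ] ｝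

Symmetric : Pred Word 0ℓ → Set
Symmetric X = X ≐ closure X

WithoutRedundancy : Pred Word 0ℓ → Set
WithoutRedundancy X =
  ∀ x y → x ∈ X → y ∈ X → x ≢ y → ¬ (x SubstringOf y)

Finite : Pred Word 0ℓ → Set
Finite X = ∃ λ (ws : List Word) → X ≐ (List._∈ ws)

------------------------------------------------------------------------
-- Exclusion sets

Ex : Pred Word 0ℓ → Pred CF 0ℓ
Ex X b = ∀ n → ∃ λ x → x ∈ X × x SubstringOfCF tail n b

record IsExclusionSet (X : Pred Word 0ℓ) : Set₁ where
  field
    symmetric         : Symmetric X
    withoutRedundancy : WithoutRedundancy X
    excludes          : Diverges ⊆ Ex X

-- The entries of a word, continued by zeros. Only A k and B k with k at
-- most the length of the word are used, and these do not see the padding.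
entry : List ℤ → CF
entry []       _       = 0ℤ
entry (b ∷ bs) zero    = b
entry (b ∷ bs) (suc i) = entry bs i

-- V w 0 = 1 ÷ 0 = ∞, and V w (suc k) is the value A₍ₖ₊₁₎ / B₍ₖ₊₁₎ of
-- [b₀ , … , bₖ], for k less than the length of w = (b₀ , … , bₙ).
V : Word → ℕ → ℚ∞
V w = convergent (entry (toList w))

-- The length of w = (b₀ , … , bₙ) is n + 1.
Ô : Pred Word 0ℓ
Ô w = V w (length w) ≡ fin 0ℚ
    × (∀ i j → i ℕ.< j → j ℕ.≤ length w → V w i ≢ V w j)

{-# OPTIONS --safe #-}

-- Two convergents Vᵢ and Vᵢ₊ⱼ coincide exactly when Bⱼ of the tail from i
-- vanishes, and a shortest repetition is a word of Ô. Hence, if some tail has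
-- no substring in Ô, the convergents are eventually distinct. As
-- Aₙ Bₙ₊₁ - Aₙ₊₁ Bₙ = 1, two consecutive convergents on different sides of
-- a rational a/c have |Bₙ| ≤ c and |Aₙ c - a Bₙ| ≤ c, which holds for
-- finitely many n only; so the convergents define a Dedekind cut or tend to ∞.
--
-- Let O be a finite exclusion set. A word w of Ô acts, up to one entry, as a
-- translation, so the periodic continued fraction c, w, c′, w, c, w, … can be
-- made to return to ∞ and to c forever and therefore diverges. With c and c′
-- larger than every letter of O, its substring from O lies inside w.
-- In particular O contains a substring of (1, 2, …, 2), with m twos, because
-- (m + 1, 1, 2, …, 2) is in Ô. The fraction m + 4, 1, 2, …, 2, m + 4, 1, …
-- repeats this substring, but its recurrence has a positive solution,
-- so Bₙ of its tails never vanishes and it has no substring in Ô.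

module Submission where

open import Axiom.ExcludedMiddle using (ExcludedMiddle)
open import Data.Bool.Base using (Bool; true; false; not)
open import Data.Empty using (⊥; ⊥-elim)
open import Data.Integer.Base as ℤ using (ℤ; +_; +[1+_]; -[1+_]; 0ℤ; 1ℤ; ∣_∣)
open import Data.Integer.GCD using (gcd)
import Data.Integer.Properties as ℤ
open import Data.Integer.Tactic.RingSolver using (solve-∀)
open import Data.List.Base as List using (List; []; _∷_; _++_; applyUpTo; replicate)
import Data.List.Membership.Propositional as List
open import Data.List.NonEmpty.Base as List⁺ using ([_]; toList; length)
  renaming (_∷_ to _∷⁺_)
import Data.List.Properties as List
open import Data.List.Relation.Binary.Infix.Heterogeneous using (Infix; here; there; _++ⁱ_)
open import Data.List.Relation.Binary.Prefix.Heterogeneous using (Prefix; []; _∷_)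
open import Data.List.Relation.Unary.All using (All; []; _∷_)
import Data.List.Relation.Unary.All.Properties as All
open import Data.List.Relation.Unary.Any using (here; there)
open import Data.Nat.Base as ℕ using (ℕ; zero; suc; _+_; _≤_; _<_; z≤n; s≤s; _⊔_)
open import Data.Nat.Induction using (<-rec)
import Data.Nat.Properties as ℕ
open import Data.Product.Base using (∃; _×_; _,_; proj₁; proj₂)
open import Data.Rational.Base as ℚ using (ℚ; ↥_; ↧_; 0ℚ; 1ℚ)
import Data.Rational.Properties as ℚ
open import Data.Sum.Base using (_⊎_; inj₁; inj₂; [_,_]′)
open import Data.Unit.Base using (tt)
open import Function.Base using (_∘_; id)
open import Level using (0ℓ)
open import Relation.Binary.Definitions using (tri<; tri≈; tri>)
open import Relation.Binary.PropositionalEquality hiding ([_])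
open import Relation.Nullary using (¬_; yes; no)
open import Relation.Unary using (Pred; _∈_; _⊆_; _⊂_)
open import Defs

-- The second-order recurrence, its solutions and their Wronskians.

-- The entry `b 0` does not occur; it enters only through the start value `A b 1`.
Solves : CF → (ℕ → ℤ) → Set
Solves b f = ∀ n → f (suc (suc n)) ≡ b (suc n) ℤ.* f (suc n) ℤ.- f n

A-solves : ∀ b → Solves b (A b)
A-solves b n = refl

B-solves : ∀ b → Solves b (B b)
B-solves b n = refl

Solves-tail : ∀ {b f} i → Solves b f → Solves (tail i b) (λ n → f (i + n))
Solves-tail i sol n
  rewrite ℕ.+-suc i (suc n) | ℕ.+-suc i n = sol (i + n)

-- The recurrence is linear. The combination is written as a two-by-two determinant, the shape
-- needed for `cross` and `Solves-split`.
Solves-wronskian : ∀ {b f g} → Solves b f → Solves b g →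
                   ∀ x y → Solves b (λ n → x ℤ.* f n ℤ.- g n ℤ.* y)
Solves-wronskian {b} {f} {g} solf solg x y n rewrite solf n | solg n =
  lemma x y (b (suc n)) (f (suc n)) (f n) (g (suc n)) (g n)
  where
  lemma : ∀ x y b f₁ f₀ g₁ g₀ →
          x ℤ.* (b ℤ.* f₁ ℤ.- f₀) ℤ.- (b ℤ.* g₁ ℤ.- g₀) ℤ.* y ≡
          b ℤ.* (x ℤ.* f₁ ℤ.- g₁ ℤ.* y) ℤ.- (x ℤ.* f₀ ℤ.- g₀ ℤ.* y)
  lemma = solve-∀

Solves-unique : ∀ {b f g} → Solves b f → Solves b g →
                f 0 ≡ g 0 → f 1 ≡ g 1 → ∀ n → f n ≡ g n
Solves-unique solf solg e₀ e₁ zero = e₀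
Solves-unique solf solg e₀ e₁ (suc zero) = e₁
Solves-unique {b} solf solg e₀ e₁ (suc (suc n)) =
  trans (solf n) (trans
    (cong₂ (λ u v → b (suc n) ℤ.* u ℤ.- v)
      (Solves-unique {b} solf solg e₀ e₁ (suc n))
      (Solves-unique {b} solf solg e₀ e₁ n))
    (sym (solg n)))

Agree : ℕ → CF → CF → Set
Agree m b b′ = ∀ i → i < m → b i ≡ b′ i

Agree-pred : ∀ {m b b′} → Agree (suc m) b b′ → Agree m b b′
Agree-pred e i i<m = e i (ℕ.m≤n⇒m≤1+n i<m)

A-cong : ∀ {b b′} m → Agree m b b′ → A b m ≡ A b′ m
A-cong zero _ = refl
A-cong (suc zero) e = e 0 (s≤s z≤n)
A-cong (suc (suc m)) e =
  cong₂ ℤ._-_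
    (cong₂ ℤ._*_ (e (suc m) ℕ.≤-refl) (A-cong (suc m) (Agree-pred e)))
    (A-cong m (Agree-pred (Agree-pred e)))

B-cong : ∀ {b b′} m → Agree m b b′ → B b m ≡ B b′ m
B-cong zero _ = refl
B-cong (suc zero) _ = refl
B-cong (suc (suc m)) e =
  cong₂ ℤ._-_
    (cong₂ ℤ._*_ (e (suc m) ℕ.≤-refl) (B-cong (suc m) (Agree-pred e)))
    (B-cong m (Agree-pred (Agree-pred e)))

-- The step matrix with rows (b, -1) and (1, 0) has determinant one.
wronskian-constant : ∀ {b f g} → Solves b f → Solves b g → ∀ n →
  f n ℤ.* g (suc n) ℤ.- f (suc n) ℤ.* g n ≡ f 0 ℤ.* g 1 ℤ.- f 1 ℤ.* g 0
wronskian-constant solf solg zero = refl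
wronskian-constant {b} {f} {g} solf solg (suc n) = trans
  (trans (cong₂ (λ u v → f (suc n) ℤ.* u ℤ.- v ℤ.* g (suc n)) (solg n) (solf n))
    (lemma (b (suc n)) (f (suc n)) (f n) (g (suc n)) (g n)))
  (wronskian-constant {b} solf solg n)
  where
  lemma : ∀ x f₁ f₀ g₁ g₀ →
          f₁ ℤ.* (x ℤ.* g₁ ℤ.- g₀) ℤ.- (x ℤ.* f₁ ℤ.- f₀) ℤ.* g₁ ≡
          f₀ ℤ.* g₁ ℤ.- f₁ ℤ.* g₀
  lemma = solve-∀

det : ∀ b n → A b n ℤ.* B b (suc n) ℤ.- A b (suc n) ℤ.* B b n ≡ 1ℤ
det b n = trans (wronskian-constant {b} (A-solves b) (B-solves b) n) (lemma (b 0))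
  where
  lemma : ∀ x → 1ℤ ℤ.* 1ℤ ℤ.- x ℤ.* 0ℤ ≡ 1ℤ
  lemma = solve-∀

-- As a function of `j`, the determinant solves the recurrence of the tail from `i` and starts with
-- 0 and, by `det`, 1, as `B` does.
cross : ∀ b i j →
        A b i ℤ.* B b (i + j) ℤ.- A b (i + j) ℤ.* B b i ≡ B (tail i b) j
cross b i = Solves-unique {tail i b}
  (Solves-wronskian {tail i b} (Solves-tail {b} i (B-solves b))
    (Solves-tail {b} i (A-solves b)) (A b i) (B b i))
  (B-solves (tail i b))
  start
  (trans (cong (λ k → A b i ℤ.* B b k ℤ.- A b k ℤ.* B b i) (ℕ.+-comm i 1)) (det b i))
  where
  start : A b i ℤ.* B b (i + 0) ℤ.- A b (i + 0) ℤ.* B b i ≡ 0ℤ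
  start rewrite ℕ.+-identityʳ i = ℤ.+-inverseʳ (A b i ℤ.* B b i)

-- Both sides start with 1 and `b 1`. This turns a vanishing `B` into a word of value 0 that begins
-- one entry later.
B-suc : ∀ b j → B b (suc j) ≡ A (tail 1 b) j
B-suc b = Solves-unique {tail 1 b}
  (Solves-tail {b} 1 (B-solves b)) (A-solves (tail 1 b)) refl (lemma (b 1))
  where
  lemma : ∀ x → x ℤ.* 1ℤ ℤ.- 0ℤ ≡ x
  lemma = solve-∀

-- Fractions in ℚ∞ by cross multiplication.

-- A view of `a ÷ b` whose cross-multiplied equation hides the reduction to lowest terms.
data Quotient (a b : ℤ) : ℚ∞ → Set where
  infinite : b ≡ 0ℤ → Quotient a b ∞
  finite   : ∀ {q} → b ≢ 0ℤ → a ℤ.* ↧ q ≡ ↥ q ℤ.* b → Quotient a b (fin q)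

/-cross : ∀ i n .{{_ : ℕ.NonZero n}} → i ℤ.* ↧ (i ℚ./ n) ≡ ↥ (i ℚ./ n) ℤ.* (+ n)
/-cross i n = begin
  i ℤ.* ↧ q              ≡⟨ cong (ℤ._* ↧ q) (ℚ.↥-/ i n) ⟨
  ↥ q ℤ.* g ℤ.* ↧ q      ≡⟨ lemma (↥ q) (↧ q) g ⟩
  ↥ q ℤ.* (↧ q ℤ.* g)    ≡⟨ cong (↥ q ℤ.*_) (ℚ.↧-/ i n) ⟩
  ↥ q ℤ.* (+ n)          ∎
  where
  open ≡-Reasoning
  q = i ℚ./ n
  g = gcd i (+ n)
  lemma : ∀ u d g → u ℤ.* g ℤ.* d ≡ u ℤ.* (d ℤ.* g)
  lemma = solve-∀

÷-quotient : ∀ a b → Quotient a b (a ÷ b)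
÷-quotient a (+ zero)  = infinite refl
÷-quotient a +[1+ n ]  = finite (λ ()) (/-cross a (suc n))
÷-quotient a -[1+ n ]  = finite (λ ())
  (ℤ.neg-injective (begin
    ℤ.- (a ℤ.* ↧ q)        ≡⟨ ℤ.neg-distribˡ-* a (↧ q) ⟩
    ℤ.- a ℤ.* ↧ q          ≡⟨ /-cross (ℤ.- a) (suc n) ⟩
    ↥ q ℤ.* +[1+ n ]       ≡⟨ ℤ.neg-distribʳ-* (↥ q) -[1+ n ] ⟨
    ℤ.- (↥ q ℤ.* -[1+ n ]) ∎))
  where
  open ≡-Reasoning
  q = ℤ.- a ℚ./ suc n

÷⇒cross : ∀ a b c d → a ÷ b ≡ c ÷ d → a ℤ.* d ≡ c ℤ.* b
÷⇒cross a b c d eq with a ÷ b | ÷-quotient a b | c ÷ d | ÷-quotient c d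
÷⇒cross a b c d refl | _ | infinite refl | _ | infinite refl =
  trans (ℤ.*-zeroʳ a) (sym (ℤ.*-zeroʳ c))
÷⇒cross a b c d refl | fin q | finite _ e | _ | finite _ e′ =
  ℤ.*-cancelʳ-≡ (a ℤ.* d) (c ℤ.* b) (↧ q) (begin
    a ℤ.* d ℤ.* ↧ q     ≡⟨ swap a d (↧ q) ⟩
    a ℤ.* ↧ q ℤ.* d     ≡⟨ cong (ℤ._* d) e ⟩
    ↥ q ℤ.* b ℤ.* d     ≡⟨ swap (↥ q) b d ⟩
    ↥ q ℤ.* d ℤ.* b     ≡⟨ cong (ℤ._* b) e′ ⟨
    c ℤ.* ↧ q ℤ.* b     ≡⟨ swap c (↧ q) b ⟩
    c ℤ.* b ℤ.* ↧ q     ∎)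
  where
  open ≡-Reasoning
  swap : ∀ x y z → x ℤ.* y ℤ.* z ≡ x ℤ.* z ℤ.* y
  swap = solve-∀

*-nonzero : ∀ {i j} → i ≢ 0ℤ → j ≢ 0ℤ → i ℤ.* j ≢ 0ℤ
*-nonzero {i} i≢0 j≢0 = [ i≢0 , j≢0 ]′ ∘ ℤ.i*j≡0⇒i≡0∨j≡0 i

-- The side conditions exclude 0 ÷ 0, for which both cross products vanish whatever the other
-- fraction is.
cross⇒÷ : ∀ a b c d → (b ≡ 0ℤ → a ≢ 0ℤ) → (d ≡ 0ℤ → c ≢ 0ℤ) →
          a ℤ.* d ≡ c ℤ.* b → a ÷ b ≡ c ÷ d
cross⇒÷ a b c d ab cd eq with a ÷ b | ÷-quotient a b | c ÷ d | ÷-quotient c d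
... | _ | infinite _ | _ | infinite _ = refl
... | _ | infinite refl | _ | finite d≢0 _ =
  ⊥-elim (*-nonzero (ab refl) d≢0 (trans eq (ℤ.*-zeroʳ c)))
... | _ | finite b≢0 _ | _ | infinite refl =
  ⊥-elim (*-nonzero (cd refl) b≢0 (trans (sym eq) (ℤ.*-zeroʳ a)))
... | fin q | finite b≢0 e | fin r | finite d≢0 e′ =
  cong fin (ℚ.≃⇒≡ (ℚ.*≡* (ℤ.*-cancelʳ-≡ _ _ (b ℤ.* d) {{ℤ.≢-nonZero (*-nonzero b≢0 d≢0)}} (begin
    ↥ q ℤ.* ↧ r ℤ.* (b ℤ.* d)     ≡⟨ l₁ (↥ q) (↧ r) b d ⟩
    ↥ q ℤ.* b ℤ.* (↧ r ℤ.* d)     ≡⟨ cong (ℤ._* (↧ r ℤ.* d)) e ⟨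
    a ℤ.* ↧ q ℤ.* (↧ r ℤ.* d)     ≡⟨ l₂ a (↧ q) (↧ r) d ⟩
    a ℤ.* d ℤ.* (↧ q ℤ.* ↧ r)     ≡⟨ cong (ℤ._* (↧ q ℤ.* ↧ r)) eq ⟩
    c ℤ.* b ℤ.* (↧ q ℤ.* ↧ r)     ≡⟨ l₃ c b (↧ q) (↧ r) ⟩
    c ℤ.* ↧ r ℤ.* (↧ q ℤ.* b)     ≡⟨ cong (ℤ._* (↧ q ℤ.* b)) e′ ⟩
    ↥ r ℤ.* d ℤ.* (↧ q ℤ.* b)     ≡⟨ l₄ (↥ r) d (↧ q) b ⟩
    ↥ r ℤ.* ↧ q ℤ.* (b ℤ.* d)     ∎))))
  where
  open ≡-Reasoning
  l₁ : ∀ x y z w → x ℤ.* y ℤ.* (z ℤ.* w) ≡ x ℤ.* z ℤ.* (y ℤ.* w)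
  l₁ = solve-∀
  l₂ : ∀ x y z w → x ℤ.* y ℤ.* (z ℤ.* w) ≡ x ℤ.* w ℤ.* (y ℤ.* z)
  l₂ = solve-∀
  l₃ : ∀ x y z w → x ℤ.* y ℤ.* (z ℤ.* w) ≡ x ℤ.* w ℤ.* (z ℤ.* y)
  l₃ = solve-∀
  l₄ : ∀ x y z w → x ℤ.* y ℤ.* (z ℤ.* w) ≡ x ℤ.* z ℤ.* (w ℤ.* y)
  l₄ = solve-∀

B≡0⇒A≢0 : ∀ b n → B b n ≡ 0ℤ → A b n ≢ 0ℤ
B≡0⇒A≢0 b n B≡0 A≡0
  with d ← det b n rewrite B≡0 | A≡0 | ℤ.*-zeroʳ (A b (suc n)) with () ← d

convergent-≡⇒ : ∀ b i j → convergent b i ≡ convergent b (i + j) → B (tail i b) j ≡ 0ℤ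
convergent-≡⇒ b i j e = trans (sym (cross b i j))
  (ℤ.i≡j⇒i-j≡0 (÷⇒cross (A b i) (B b i) (A b (i + j)) (B b (i + j)) e))

convergent-≡⇐ : ∀ b i j → B (tail i b) j ≡ 0ℤ → convergent b i ≡ convergent b (i + j)
convergent-≡⇐ b i j e = cross⇒÷ (A b i) (B b i) (A b (i + j)) (B b (i + j))
  (B≡0⇒A≢0 b i) (B≡0⇒A≢0 b (i + j))
  (ℤ.i-j≡0⇒i≡j _ _ (trans (cross b i j) e))

-- Membership in `Ô` over the integers, and symmetry.

letters : Word → CF
letters w = entry (toList w)

-- Cross-multiplied form of `Ô`: by `cross`, the `B` of a tail measures whether two vertices
-- coincide, and `suc j` is the difference of their indices.
Ôᶜ : Word → Set
Ôᶜ w = A (letters w) (length w) ≡ 0ℤ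
    × (∀ i j → i + suc j ≤ length w → B (tail i (letters w)) (suc j) ≢ 0ℤ)

Ô⇒Ôᶜ : ∀ w → w ∈ Ô → Ôᶜ w
Ô⇒Ôᶜ w (value , distinct) =
  trans (sym (ℤ.*-identityʳ _)) (÷⇒cross a b 0ℤ 1ℤ value) ,
  λ i j le e → distinct i (i + suc j) (ℕ.m<m+n i (s≤s z≤n)) le (convergent-≡⇐ (letters w) i (suc j) e)
  where
  a = A (letters w) (length w)
  b = B (letters w) (length w)

Ôᶜ⇒Ô : ∀ w → Ôᶜ w → w ∈ Ô
Ôᶜ⇒Ô w (value , nonzero) =
  cross⇒÷ a b 0ℤ 1ℤ (B≡0⇒A≢0 (letters w) (length w)) (λ ()) (trans (ℤ.*-identityʳ a) value) ,
  λ i j i<j le e → distinct i j (ℕ.m≤n⇒∃[o]m+o≡n i<j) le e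
  where
  a = A (letters w) (length w)
  b = B (letters w) (length w)
  distinct : ∀ i j → (∃ λ d → suc i + d ≡ j) → j ≤ length w → V w i ≢ V w j
  distinct i _ (d , refl) le e =
    nonzero i d (ℕ.≤-trans (ℕ.≤-reflexive (ℕ.+-suc i d)) le)
      (convergent-≡⇒ (letters w) i (suc d) (trans e (cong (V w) (sym (ℕ.+-suc i d)))))

-- The term `f n` times the n-th power of -1, which is how solutions change when all entries are
-- negated.
alternate : (ℕ → ℤ) → ℕ → ℤ
alternate f zero    = f zero
alternate f (suc n) = ℤ.- alternate (f ∘ suc) n

alternate-solves : ∀ {b f} → Solves b f → Solves (ℤ.-_ ∘ b) (alternate f)
alternate-solves {b} {f} sol zero rewrite sol 0 = lemma (b 1) (f 1) (f 0)
  where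
  lemma : ∀ x u v → ℤ.- (ℤ.- (x ℤ.* u ℤ.- v)) ≡ ℤ.- x ℤ.* ℤ.- u ℤ.- v
  lemma = solve-∀
alternate-solves {b} {f} sol (suc n)
  rewrite alternate-solves {b ∘ suc} {f ∘ suc} (sol ∘ suc) n =
  lemma (b (suc (suc n))) (alternate (f ∘ suc) (suc n)) (alternate (f ∘ suc) n)
  where
  lemma : ∀ x u v → ℤ.- (ℤ.- x ℤ.* u ℤ.- v) ≡ ℤ.- x ℤ.* ℤ.- u ℤ.- ℤ.- v
  lemma = solve-∀

alternate-≡0 : ∀ f n → alternate f n ≡ 0ℤ → f n ≡ 0ℤ
alternate-≡0 f zero    e = e
alternate-≡0 f (suc n) e = alternate-≡0 (f ∘ suc) n (ℤ.neg-injective e)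

≡0-alternate : ∀ f n → f n ≡ 0ℤ → alternate f n ≡ 0ℤ
≡0-alternate f zero    e = e
≡0-alternate f (suc n) e = cong ℤ.-_ (≡0-alternate (f ∘ suc) n e)

A-negate : ∀ b n → A (ℤ.-_ ∘ b) n ≡ alternate (A b) n
A-negate b =
  Solves-unique {ℤ.-_ ∘ b} (A-solves (ℤ.-_ ∘ b)) (alternate-solves {b} (A-solves b)) refl refl

-- The inner minus sign compensates for the alternation at index 1, where both sides must be 1.
B-negate : ∀ b n → B (ℤ.-_ ∘ b) n ≡ alternate (ℤ.-_ ∘ B b) n
B-negate b =
  Solves-unique {ℤ.-_ ∘ b} (B-solves (ℤ.-_ ∘ b)) (alternate-solves {b} sol) refl refl
  where
  lemma : ∀ x u v → ℤ.- (x ℤ.* u ℤ.- v) ≡ x ℤ.* ℤ.- u ℤ.- ℤ.- v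
  lemma = solve-∀
  sol : Solves b (ℤ.-_ ∘ B b)
  sol n = lemma (b (suc n)) (B b (suc n)) (B b n)

entry-negate : ∀ xs i → entry (List.map ℤ.-_ xs) i ≡ ℤ.- entry xs i
entry-negate []       i       = refl
entry-negate (x ∷ xs) zero    = refl
entry-negate (x ∷ xs) (suc i) = entry-negate xs i

Ôᶜ-negate : ∀ w → Ôᶜ w → Ôᶜ (negate w)
Ôᶜ-negate w@(x ∷⁺ xs) (value , nonzero) rewrite List.length-map ℤ.-_ xs =
  trans (A-cong m (λ i _ → entry-negate (toList w) i))
    (trans (A-negate (letters w) m) (≡0-alternate (A (letters w)) m value)) ,
  λ i j le e → nonzero i j le (ℤ.neg-injective (alternate-≡0 (ℤ.-_ ∘ B (tail i (letters w))) (suc j)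
    (trans (sym (trans (B-cong (suc j) (λ k _ → entry-negate (toList w) (i + k)))
      (B-negate (tail i (letters w)) (suc j)))) e)))
  where m = length w

[0]∈Ô : [ 0ℤ ] ∈ Ô
[0]∈Ô = refl , λ where
  zero    zero          ()       _
  zero    (suc zero)    _        _        ()
  (suc _) (suc zero)    (s≤s ()) _
  _       (suc (suc _)) _        (s≤s ())

Ô-symmetric : Symmetric Ô
Ô-symmetric = inj₁ , λ where
  (inj₁ w∈Ô) → w∈Ô
  (inj₂ (inj₁ (x , x∈Ô , refl))) → Ôᶜ⇒Ô (negate x) (Ôᶜ-negate x (Ô⇒Ôᶜ x x∈Ô))
  (inj₂ (inj₂ refl)) → [0]∈Ô

-- Substrings as pointwise agreement, and absence of redundancy.

_⊑_at_ : List ℤ → CF → ℕ → Set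
xs ⊑ b at r = Agree (List.length xs) (entry xs) (tail r b)

applyUpTo⇒⊑ : ∀ xs b {n} → xs ≡ applyUpTo b n → Agree (List.length xs) (entry xs) b
applyUpTo⇒⊑ (x ∷ xs) b {suc n} e zero    _       = List.∷-injectiveˡ e
applyUpTo⇒⊑ (x ∷ xs) b {suc n} e (suc i) (s≤s p) = applyUpTo⇒⊑ xs (b ∘ suc) (List.∷-injectiveʳ e) i p

⊑⇒applyUpTo : ∀ xs b → Agree (List.length xs) (entry xs) b → xs ≡ applyUpTo b (List.length xs)
⊑⇒applyUpTo []       b e = refl
⊑⇒applyUpTo (x ∷ xs) b e = cong₂ _∷_ (e 0 (s≤s z≤n)) (⊑⇒applyUpTo xs (b ∘ suc) (λ i p → e (suc i) (s≤s p)))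

-- The final bound rules out agreement with the zeros that pad `entry ys`.
infix⇒⊑ : ∀ {xs ys} → Infix _≡_ xs ys → ∃ λ r → xs ⊑ entry ys at r × r + List.length xs ≤ List.length ys
infix⇒⊑ (here p)  = 0 , prefix p
  where
  prefix : ∀ {xs ys} → Prefix _≡_ xs ys → xs ⊑ entry ys at 0 × List.length xs ≤ List.length ys
  prefix []         = (λ _ ()) , z≤n
  prefix (refl ∷ p) with e , le ← prefix p =
    (λ { zero _ → refl ; (suc i) (s≤s q) → e i q }) , s≤s le
infix⇒⊑ (there p) with r , e , le ← infix⇒⊑ p = suc r , e , s≤s le

Agree⇒Prefix : ∀ xs ys → Agree (List.length xs) (entry xs) (entry ys) →
               List.length xs ≤ List.length ys → Prefix _≡_ xs ys
Agree⇒Prefix []       ys       e le = []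
Agree⇒Prefix (x ∷ xs) (y ∷ ys) e (s≤s le) =
  e 0 (s≤s z≤n) ∷ Agree⇒Prefix xs ys (λ i p → e (suc i) (s≤s p)) le

Agree⇒≡ : ∀ xs ys → Agree (List.length xs) (entry xs) (entry ys) →
          List.length xs ≡ List.length ys → xs ≡ ys
Agree⇒≡ []       []       _ _ = refl
Agree⇒≡ (x ∷ xs) (y ∷ ys) e l =
  cong₂ _∷_ (e 0 (s≤s z≤n)) (Agree⇒≡ xs ys (λ i p → e (suc i) (s≤s p)) (ℕ.suc-injective l))

-- If `x` occurs in `y` after an initial letter, the path of `y` returns to the vertex just before
-- that letter. If `x` is a proper prefix of `y`, the path of `y` reaches 0 twice.
Ô-withoutRedundancy : WithoutRedundancy Ô
Ô-withoutRedundancy x@(_ ∷⁺ _) y@(_ ∷⁺ _) x∈ y∈ x≢y inf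
  with infix⇒⊑ inf | Ô⇒Ôᶜ x x∈ | Ô⇒Ôᶜ y y∈
... | suc r , e , le | vx , _ | vy , nz =
  nz r (length x) (ℕ.≤-trans (ℕ.≤-reflexive (ℕ.+-suc r (length x))) le) (begin
    B (tail r (letters y)) (suc (length x))       ≡⟨ B-suc (tail r (letters y)) (length x) ⟩
    A (tail 1 (tail r (letters y))) (length x)    ≡⟨ A-cong (length x) (λ i p →
      trans (cong (letters y) (ℕ.+-suc r i)) (sym (e i p))) ⟩
    A (letters x) (length x)                      ≡⟨ vx ⟩
    0ℤ                                            ∎)
  where open ≡-Reasoning
... | zero , e , le | vx , _ | vy , nz with ℕ.m≤n⇒m<n∨m≡n le
...   | inj₂ l with refl ← Agree⇒≡ (toList x) (toList y) e l = x≢y refl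
...   | inj₁ l with d , eq ← ℕ.m≤n⇒∃[o]m+o≡n l =
  nz (length x) d (ℕ.≤-reflexive lenEq)
    (trans (sym (cross (letters y) (length x) (suc d))) (begin
      A′ (length x) ℤ.* B′ (length x + suc d) ℤ.- A′ (length x + suc d) ℤ.* B′ (length x)
        ≡⟨ cong₂ (λ u v → u ℤ.* B′ (length x + suc d) ℤ.- v ℤ.* B′ (length x))
            (trans (sym (A-cong (length x) e)) vx) (trans (cong A′ lenEq) vy) ⟩
      0ℤ ∎))
  where
  open ≡-Reasoning
  A′ = A (letters y)
  B′ = B (letters y)
  lenEq : length x + suc d ≡ length y
  lenEq = trans (ℕ.+-suc (length x) d) eq

-- Eventual properties of integer sequences.

Eventually : Pred ℕ 0ℓ → Set
Eventually P = ∃ λ N → ∀ k → N ≤ k → P k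

Eventually-map : ∀ {P Q : Pred ℕ 0ℓ} → (∀ k → P k → Q k) → Eventually P → Eventually Q
Eventually-map f (N , p) = N , λ k le → f k (p k le)

Eventually-zip : ∀ {P Q R : Pred ℕ 0ℓ} → (∀ k → P k → Q k → R k) →
                 Eventually P → Eventually Q → Eventually R
Eventually-zip f (M , p) (N , q) = M ⊔ N , λ k le →
  f k (p k (ℕ.≤-trans (ℕ.m≤m⊔n M N) le)) (q k (ℕ.≤-trans (ℕ.m≤n⊔m M N) le))

Eventually-suc : ∀ {P : Pred ℕ 0ℓ} → Eventually P → Eventually (P ∘ suc)
Eventually-suc (N , p) = N , λ k le → p (suc k) (ℕ.m≤n⇒m≤1+n le)

Eventually-∃ : ∀ {P : Pred ℕ 0ℓ} → Eventually P → ∃ P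
Eventually-∃ (N , p) = N , p N ℕ.≤-refl

-- Finitely many thresholds have a maximum; the induction adds `c + 1` and its negative at each
-- step.
Eventually-bounded : ∀ {Q : ℕ → Pred ℤ 0ℓ} → (∀ x → Eventually λ k → ¬ Q k x) →
                     ∀ c → Eventually λ k → ∀ x → ∣ x ∣ ≤ c → ¬ Q k x
Eventually-bounded {Q} ev zero = Eventually-map
  (λ { k ¬q x le q → ¬q (subst (Q k) (ℤ.∣i∣≡0⇒i≡0 (ℕ.n≤0⇒n≡0 le)) q) }) (ev 0ℤ)
Eventually-bounded {Q} ev (suc c) =
  Eventually-zip extend (Eventually-zip (λ k → _,_) (ev (+ suc c)) (ev -[1+ c ]))
    (Eventually-bounded {Q} ev c)
  where
  extend : ∀ k → ¬ Q k (+ suc c) × ¬ Q k -[1+ c ] →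
           (∀ x → ∣ x ∣ ≤ c → ¬ Q k x) → ∀ x → ∣ x ∣ ≤ suc c → ¬ Q k x
  extend k (¬+ , ¬-) rest x le with ℕ.m≤n⇒m<n∨m≡n le
  extend k (¬+ , ¬-) rest x        le | inj₁ (s≤s lt) = rest x lt
  extend k (¬+ , ¬-) rest (+ _)    le | inj₂ refl = ¬+
  extend k (¬+ , ¬-) rest -[1+ _ ] le | inj₂ refl = ¬-

*-pos-neg : ∀ {i j} → 0ℤ ℤ.< i → j ℤ.< 0ℤ → i ℤ.* j ℤ.< 0ℤ
*-pos-neg {+[1+ m ]} { -[1+ n ]} _ _ = ℤ.-<+
*-pos-neg {+ zero} (ℤ.+<+ ()) _
*-pos-neg {_} {+ n} _ (ℤ.+<+ ())

-- Beyond a common threshold `N` the sign of `h N` passes from each term to the next.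
constant-sign : ∀ {h : ℕ → ℤ} →
  (Eventually λ k → h k ≢ 0ℤ) → (Eventually λ k → ¬ (h k ℤ.* h (suc k) ℤ.< 0ℤ)) →
  (Eventually λ k → 0ℤ ℤ.< h k) ⊎ (Eventually λ k → h k ℤ.< 0ℤ)
constant-sign {h} nz same with N , p ← Eventually-zip (λ k → _,_) nz same = go
  where
  propagate : ∀ {P : Pred ℕ 0ℓ} → P N → (∀ k → N ≤ k → P k → P (suc k)) → ∀ k → N ≤ k → P k
  propagate {P} p₀ step k le with d , refl ← ℕ.m≤n⇒∃[o]m+o≡n le = climb d
    where
    climb : ∀ d → P (N + d)
    climb zero    = subst P (sym (ℕ.+-identityʳ N)) p₀
    climb (suc d) = subst P (sym (ℕ.+-suc N d)) (step (N + d) (ℕ.m≤m+n N d) (climb d))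
  pos : ∀ k → N ≤ k → 0ℤ ℤ.< h k → 0ℤ ℤ.< h (suc k)
  pos k le 0<h with ℤ.<-cmp 0ℤ (h (suc k))
  ... | tri< 0<h′ _ _ = 0<h′
  ... | tri≈ _ 0≡h′ _ = ⊥-elim (proj₁ (p (suc k) (ℕ.m≤n⇒m≤1+n le)) (sym 0≡h′))
  ... | tri> _ _ h′<0 = ⊥-elim (proj₂ (p k le) (*-pos-neg 0<h h′<0))
  neg′ : ∀ k → N ≤ k → h k ℤ.< 0ℤ → h (suc k) ℤ.< 0ℤ
  neg′ k le h<0 with ℤ.<-cmp 0ℤ (h (suc k))
  ... | tri< 0<h′ _ _ = ⊥-elim (proj₂ (p k le)
          (subst (ℤ._< 0ℤ) (ℤ.*-comm (h (suc k)) (h k)) (*-pos-neg 0<h′ h<0)))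
  ... | tri≈ _ 0≡h′ _ = ⊥-elim (proj₁ (p (suc k) (ℕ.m≤n⇒m≤1+n le)) (sym 0≡h′))
  ... | tri> _ _ h′<0 = h′<0
  go : (Eventually λ k → 0ℤ ℤ.< h k) ⊎ (Eventually λ k → h k ℤ.< 0ℤ)
  go with ℤ.<-cmp 0ℤ (h N)
  ... | tri< 0<h _ _ = inj₁ (N , propagate 0<h pos)
  ... | tri≈ _ 0≡h _ = ⊥-elim (proj₁ (p N ℕ.≤-refl) (sym 0≡h))
  ... | tri> _ _ h<0 = inj₂ (N , propagate h<0 neg′)

-- For opposite signs, the absolute values add up to that of the difference.
opposite-sign-difference : ∀ {i j c} → i ℤ.* j ℤ.< 0ℤ → i ℤ.- j ≡ + c → ∣ i ∣ ≤ c × ∣ j ∣ ≤ c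
opposite-sign-difference {+ zero} {j} lt e = ⊥-elim (ℤ.<-irrefl refl lt)
opposite-sign-difference {+[1+ m ]} {+ n} lt e =
  ⊥-elim (ℤ.<⇒≱ lt (subst (0ℤ ℤ.≤_) (ℤ.pos-* (suc m) n) (ℤ.+≤+ z≤n)))
opposite-sign-difference {+[1+ m ]} { -[1+ n ]} lt refl =
  ℕ.m≤m+n (suc m) (suc n) , ℕ.m≤n+m (suc n) (suc m)
opposite-sign-difference { -[1+ m ]} {+ zero} lt ()
opposite-sign-difference { -[1+ m ]} {+[1+ n ]} lt ()
opposite-sign-difference { -[1+ m ]} { -[1+ n ]} (ℤ.+<+ ()) e

∣i∣≤∣i*j∣ : ∀ i {j} → j ≢ 0ℤ → ∣ i ∣ ≤ ∣ i ℤ.* j ∣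
∣i∣≤∣i*j∣ i {j} j≢0 = subst (∣ i ∣ ≤_) (sym (ℤ.abs-* i j))
  (ℕ.m≤m*n ∣ i ∣ ∣ j ∣ {{ℤ.≢-nonZero j≢0}})

-- Comparison with rationals and basic neighbourhoods.

data _<∞_ : ℚ∞ → ℚ → Set where
  fin : ∀ {q x} → q ℚ.< x → fin q <∞ x

data _>∞_ : ℚ∞ → ℚ → Set where
  fin : ∀ {q x} → x ℚ.< q → fin q >∞ x

<∞-weaken : ∀ {z x y} → x ℚ.< y → z <∞ x → z <∞ y
<∞-weaken x<y (fin q<x) = fin (ℚ.<-trans q<x x<y)

>∞-weaken : ∀ {z x y} → y ℚ.< x → z >∞ x → z >∞ y
>∞-weaken y<x (fin x<q) = fin (ℚ.<-trans y<x x<q)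

<∞⇒exterior : ∀ {z M} → z <∞ (ℚ.- M) → ι z ∈ᵒ exterior M
<∞⇒exterior (fin q<-M) = inj₁ (inj₁ q<-M)

>∞⇒exterior : ∀ {z M} → z >∞ M → ι z ∈ᵒ exterior M
>∞⇒exterior (fin M<q) = inj₁ (inj₂ M<q)

-- Either inequality makes `M` negative, so that the removed square is empty and the exterior is the
-- whole sphere.
imaginary⇒exterior : ∀ z {M} → 0ℚ ℚ.< ℚ.- M ⊎ M ℚ.< 0ℚ → ι z ∈ᵒ exterior M
imaginary⇒exterior ∞       _ = tt
imaginary⇒exterior (fin _) p = inj₂ p

>∞∧<∞⇒rectangle : ∀ {z p q r s} → z >∞ p → z <∞ q → r ℚ.< 0ℚ × 0ℚ ℚ.< s →
                  ι z ∈ᵒ rectangle p q r s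
>∞∧<∞⇒rectangle (fin p<x) (fin x<q) imaginary = (p<x , x<q) , imaginary

-- b · excess a b x has the sign of a/b - x.
excess : ℤ → ℤ → ℚ → ℤ
excess a b x = a ℤ.* ↧ x ℤ.- ↥ x ℤ.* b

-- The last factor is the numerator of `q - x` over the product of the denominators. The extra
-- factor `b` on the left turns into a square, so the sign of `b` is immaterial.
excess-quotient : ∀ {a b q} x → a ℤ.* ↧ q ≡ ↥ q ℤ.* b →
  ↧ q ℤ.* (excess a b x ℤ.* b) ≡ b ℤ.* b ℤ.* (↥ q ℤ.* ↧ x ℤ.- ↥ x ℤ.* ↧ q)
excess-quotient {a} {b} {q} x e = begin
  ↧ q ℤ.* (excess a b x ℤ.* b) ≡⟨ l₁ a b (↧ q) (↥ x) (↧ x) ⟩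
  b ℤ.* ((a ℤ.* ↧ q) ℤ.* ↧ x ℤ.- ↥ x ℤ.* b ℤ.* ↧ q) ≡⟨
    cong (λ u → b ℤ.* (u ℤ.* ↧ x ℤ.- ↥ x ℤ.* b ℤ.* ↧ q)) e ⟩
  b ℤ.* ((↥ q ℤ.* b) ℤ.* ↧ x ℤ.- ↥ x ℤ.* b ℤ.* ↧ q) ≡⟨ l₂ (↥ q) b (↧ q) (↥ x) (↧ x) ⟩
  b ℤ.* b ℤ.* (↥ q ℤ.* ↧ x ℤ.- ↥ x ℤ.* ↧ q) ∎
  where
  open ≡-Reasoning
  l₁ : ∀ a b d u v → d ℤ.* ((a ℤ.* v ℤ.- u ℤ.* b) ℤ.* b) ≡ b ℤ.* ((a ℤ.* d) ℤ.* v ℤ.- u ℤ.* b ℤ.* d)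
  l₁ = solve-∀
  l₂ : ∀ n b d u v → b ℤ.* ((n ℤ.* b) ℤ.* v ℤ.- u ℤ.* b ℤ.* d) ≡ b ℤ.* b ℤ.* (n ℤ.* v ℤ.- u ℤ.* d)
  l₂ = solve-∀

square-nonneg : ∀ i → 0ℤ ℤ.≤ i ℤ.* i
square-nonneg (+ n) = subst (0ℤ ℤ.≤_) (ℤ.pos-* n n) (ℤ.+≤+ z≤n)
square-nonneg -[1+ n ] = ℤ.+≤+ z≤n

*-nonneg-nonpos : ∀ {i j} → 0ℤ ℤ.≤ i → j ℤ.≤ 0ℤ → i ℤ.* j ℤ.≤ 0ℤ
*-nonneg-nonpos {i} {j} 0≤i j≤0 = subst (i ℤ.* j ℤ.≤_) (ℤ.*-zeroʳ i)
  (ℤ.*-monoˡ-≤-nonNeg i {{ℤ.nonNegative 0≤i}} j≤0)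

excess<0⇒<∞ : ∀ {a b x} → excess a b x ℤ.* b ℤ.< 0ℤ → (a ÷ b) <∞ x
excess<0⇒<∞ {a} {b} {x} lt with a ÷ b | ÷-quotient a b
... | _ | infinite refl = ⊥-elim (ℤ.<-irrefl (ℤ.*-zeroʳ (excess a 0ℤ x)) lt)
... | fin q | finite _ e with q ℚ.<? x
...   | yes q<x = fin q<x
...   | no  q≮x = ⊥-elim (ℤ.<⇒≱ (*-pos-neg {↧ q} (ℤ.+<+ (s≤s z≤n)) lt)
          (subst (0ℤ ℤ.≤_) (sym (excess-quotient {a} {b} {q} x e))
            (subst (ℤ._≤ b ℤ.* b ℤ.* (↥ q ℤ.* ↧ x ℤ.- ↥ x ℤ.* ↧ q)) (ℤ.*-zeroʳ (b ℤ.* b))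
              (ℤ.*-monoˡ-≤-nonNeg (b ℤ.* b) {{ℤ.nonNegative (square-nonneg b)}}
                (ℤ.i≤j⇒0≤j-i (ℚ.drop-*≤* (ℚ.≮⇒≥ q≮x)))))))

0<excess⇒>∞ : ∀ {a b x} → 0ℤ ℤ.< excess a b x ℤ.* b → (a ÷ b) >∞ x
0<excess⇒>∞ {a} {b} {x} lt with a ÷ b | ÷-quotient a b
... | _ | infinite refl = ⊥-elim (ℤ.<-irrefl (sym (ℤ.*-zeroʳ (excess a 0ℤ x))) lt)
... | fin q | finite _ e with x ℚ.<? q
...   | yes x<q = fin x<q
...   | no  x≮q = ⊥-elim (ℤ.<⇒≱
          (subst (ℤ._< ↧ q ℤ.* (excess a b x ℤ.* b)) (ℤ.*-zeroʳ (↧ q)) (ℤ.*-monoˡ-<-pos (↧ q) lt))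
          (subst (ℤ._≤ 0ℤ) (sym (excess-quotient {a} {b} {q} x e))
            (*-nonneg-nonpos (square-nonneg b) (ℤ.i≤j⇒i-j≤0 (ℚ.drop-*≤* (ℚ.≮⇒≥ x≮q))))))

-- Convergence of eventually distinct convergents.

module _ (em : ExcludedMiddle 0ℓ) where

  -- Excluded middle decides whether `P` occurs from `N` on; past one occurrence there is no other.
  at-most-once⇒eventually-not : ∀ (P : Pred ℕ 0ℓ) N →
    (∀ {i j} → N ≤ i → i < j → P i → ¬ P j) → Eventually λ k → ¬ P k
  at-most-once⇒eventually-not P N once with em {∃ λ k → N ≤ k × P k}
  ... | yes (i , N≤i , p) = suc i , λ j i<j → once N≤i i<j p
  ... | no  ¬p            = N , λ k N≤k p → ¬p (k , N≤k , p)

  module _ (b : CF) (N : ℕ)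
           (distinct : ∀ {i j} → N ≤ i → i < j → A b i ℤ.* B b j ≢ A b j ℤ.* B b i)
           where

    private
      X : ℚ → ℕ → ℤ
      X x k = excess (A b k) (B b k) x

    -- The pair (`X x k`, `B b k`) is the image of (`A b k`, `B b k`) under a linear map of
    -- determinant `↧ x`.
    X-cross : ∀ x i j → X x i ℤ.* B b j ℤ.- X x j ℤ.* B b i ≡
              ↧ x ℤ.* (A b i ℤ.* B b j ℤ.- A b j ℤ.* B b i)
    X-cross x i j = lemma (A b i) (A b j) (B b i) (B b j) (↥ x) (↧ x)
      where
      lemma : ∀ a a′ b b′ u v → (a ℤ.* v ℤ.- u ℤ.* b) ℤ.* b′ ℤ.- (a′ ℤ.* v ℤ.- u ℤ.* b′) ℤ.* b ≡
              v ℤ.* (a ℤ.* b′ ℤ.- a′ ℤ.* b)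
      lemma = solve-∀

    X-distinct : ∀ x {i j} → N ≤ i → i < j → X x i ℤ.* B b j ≢ X x j ℤ.* B b i
    X-distinct x {i} {j} N≤i i<j e = *-nonzero {↧ x} (λ ())
      (distinct N≤i i<j ∘ ℤ.i-j≡0⇒i≡j _ _)
      (trans (sym (X-cross x i j)) (ℤ.i≡j⇒i-j≡0 e))

    -- Zeros at two indices would make both convergents equal to `x`.
    X≢0 : ∀ x → Eventually λ k → X x k ≢ 0ℤ
    X≢0 x = at-most-once⇒eventually-not _ N λ {i} {j} N≤i i<j p q →
      X-distinct x N≤i i<j (trans (cong (ℤ._* B b j) p) (cong (ℤ._* B b i) (sym q)))

    B≢0 : Eventually λ k → B b k ≢ 0ℤ
    B≢0 = at-most-once⇒eventually-not _ N λ {i} {j} N≤i i<j p q →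
      distinct N≤i i<j (trans (cong (A b i ℤ.*_) q)
        (trans (ℤ.*-zeroʳ (A b i)) (sym (trans (cong (A b j ℤ.*_) p) (ℤ.*-zeroʳ (A b j))))))

    X,B≢ : ∀ x y z → Eventually λ k → ¬ (X x k ≡ y × B b k ≡ z)
    X,B≢ x y z = at-most-once⇒eventually-not _ N λ {i} {j} N≤i i<j (p , p′) (q , q′) →
      X-distinct x N≤i i<j (cong₂ ℤ._*_ (trans p (sym q)) (trans q′ (sym p′)))

    -- A square holds finitely many integer pairs, each met at most once from `N` on;
    -- `Eventually-bounded` treats one coordinate at a time.
    X,B-unbounded : ∀ x c → Eventually λ k → ¬ (∣ X x k ∣ ≤ c × ∣ B b k ∣ ≤ c)
    X,B-unbounded x c = Eventually-map (λ k f (p , q) → f _ p (_ , q , refl , refl))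
      (Eventually-bounded {λ k y → ∃ λ z → ∣ z ∣ ≤ c × X x k ≡ y × B b k ≡ z}
        (λ y → Eventually-map (λ k f (z , p , q) → f z p q)
          (Eventually-bounded {λ k z → X x k ≡ y × B b k ≡ z} (X,B≢ x y) c)) c)

    -- At a crossing, `X x k * B b (suc k)` and `X x (suc k) * B b k` have opposite signs and
    -- difference `↧ x`. This bounds both products, and with them `X x k` and `B b k`.
    no-crossing : ∀ x → Eventually λ k →
      ¬ (X x k ℤ.* B b k ℤ.* (X x (suc k) ℤ.* B b (suc k)) ℤ.< 0ℤ)
    no-crossing x = Eventually-zip
      (λ { k (B≢0 , B′≢0) unb lt →
        let p , q = opposite-sign-difference {X x k ℤ.* B b (suc k)} {X x (suc k) ℤ.* B b k}
                (subst (ℤ._< 0ℤ) (rearrange (X x k) (B b k) (X x (suc k)) (B b (suc k))) lt)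
                (trans (X-cross x k (suc k))
                  (trans (cong (↧ x ℤ.*_) (det b k)) (ℤ.*-identityʳ (↧ x))))
            in unb (ℕ.≤-trans (∣i∣≤∣i*j∣ (X x k) B′≢0) p ,
                ℕ.≤-trans (∣i∣≤∣i*j∣ (B b k) (X′≢0 k lt))
                  (subst (λ u → ∣ u ∣ ≤ _) (ℤ.*-comm (X x (suc k)) (B b k)) q)) })
      (Eventually-zip (λ k → _,_) B≢0 (Eventually-suc B≢0))
      (X,B-unbounded x (ℚ.↧ₙ x))
      where
      rearrange : ∀ u v u′ v′ → u ℤ.* v ℤ.* (u′ ℤ.* v′) ≡ u ℤ.* v′ ℤ.* (u′ ℤ.* v)
      rearrange = solve-∀
      X′≢0 : ∀ k → X x k ℤ.* B b k ℤ.* (X x (suc k) ℤ.* B b (suc k)) ℤ.< 0ℤ → X x (suc k) ≢ 0ℤ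
      X′≢0 k lt e = ℤ.<-irrefl
        (trans (cong (λ u → X x k ℤ.* B b k ℤ.* (u ℤ.* B b (suc k))) e) (ℤ.*-zeroʳ (X x k ℤ.* B b k))) lt

    Eventually> Eventually< : Pred ℚ 0ℓ
    Eventually> x = Eventually λ k → convergent b k >∞ x
    Eventually< x = Eventually λ k → convergent b k <∞ x

    dichotomy : ∀ x → Eventually> x ⊎ Eventually< x
    dichotomy x =
      [ inj₁ ∘ Eventually-map (λ k → 0<excess⇒>∞ {A b k} {B b k} {x})
      , inj₂ ∘ Eventually-map (λ k → excess<0⇒<∞ {A b k} {B b k} {x}) ]′
      (constant-sign {λ k → X x k ℤ.* B b k}
        (Eventually-zip (λ k → *-nonzero {X x k} {B b k}) (X≢0 x) B≢0) (no-crossing x))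

    -- The strict gap between `q` and `r` makes both halves of the cut rounded; locatedness is
    -- `dichotomy` at an intermediate point.
    limit : ∃ Eventually> → ∃ Eventually< → ℝ
    limit (l , >l) (u , <u) = record
      { L         = λ q → ∃ λ r → q ℚ.< r × Eventually> r
      ; U         = λ q → ∃ λ r → r ℚ.< q × Eventually< r
      ; inhabited = (l ℚ.- 1ℚ , l , proj₂ (proj₁ (ℝ.inhabited (fromℚ l))) , >l) ,
                    (u ℚ.+ 1ℚ , u , proj₂ (proj₂ (ℝ.inhabited (fromℚ u))) , <u)
      ; L-rounded = λ (r , q<r , >r) → let m , q<m , m<r = ℚ.<-dense q<r in m , q<m , r , m<r , >r
      ; L-closed  = λ q<r (s , r<s , >s) → s , ℚ.<-trans q<r r<s , >s
      ; U-rounded = λ (r , r<q , <r) → let m , r<m , m<q = ℚ.<-dense r<q in m , m<q , r , r<m , <r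
      ; U-closed  = λ r<q (s , s<r , <s) → s , ℚ.<-trans s<r r<q , <s
      ; disjoint  = λ q ((r , q<r , >r) , (s , s<q , <s)) →
          absurd (ℚ.<-trans s<q q<r) (proj₂ (Eventually-∃ (Eventually-zip (λ _ → _,_) >r <s)))
      ; located   = λ q<r → let m , q<m , m<r = ℚ.<-dense q<r in
          [ (λ >m → inj₁ (m , q<m , >m)) , (λ <m → inj₂ (m , m<r , <m)) ]′ (dichotomy m)
      }
      where
      absurd : ∀ {r s z} → s ℚ.< r → z >∞ r × z <∞ s → ⊥
      absurd s<r (fin r<q , fin q<s) = ℚ.<-asym s<r (ℚ.<-trans r<q q<s)

    -- Without an eventual lower bound, `dichotomy` puts the convergents below every rational, so
    -- they tend to ∞; likewise without an upper bound. With both bounds they define a cut.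
    converges : Converges b
    converges with em {∃ Eventually>} | em {∃ Eventually<}
    ... | no ¬> | _ = ∞ , λ where
      (exterior M) _ → Eventually-map (λ k → <∞⇒exterior {convergent b k} {M})
        ([ ⊥-elim ∘ ¬> ∘ (ℚ.- M ,_) , id ]′ (dichotomy (ℚ.- M)))
    ... | yes _ | no ¬< = ∞ , λ where
      (exterior M) _ → Eventually-map (λ k → >∞⇒exterior {convergent b k} {M})
        ([ id , ⊥-elim ∘ ¬< ∘ (M ,_) ]′ (dichotomy M))
    ... | yes l | yes u = (limit l u +i fromℚ 0ℚ) , λ where
      (rectangle p q r s) (((p′ , p<p′ , >p′) , (q′ , q′<q , <q′)) , imaginary) →
        Eventually-zip
          (λ k >p <q → >∞∧<∞⇒rectangle (>∞-weaken p<p′ >p) (<∞-weaken q′<q <q) imaginary) >p′ <q′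
      (exterior M) (inj₁ (inj₁ (r , r<-M , <r))) →
        Eventually-map (λ k → <∞⇒exterior {convergent b k} {M} ∘ <∞-weaken r<-M) <r
      (exterior M) (inj₁ (inj₂ (r , M<r , >r)))  →
        Eventually-map (λ k → >∞⇒exterior {convergent b k} {M} ∘ >∞-weaken M<r) >r
      (exterior M) (inj₂ imaginary) → 0 , λ k _ → imaginary⇒exterior (convergent b k) imaginary

-- Loops in the path of convergents, and `Ô` as an exclusion set.

word : CF → ℕ → Word
word b m = b 0 ∷⁺ applyUpTo (b ∘ suc) m

length-word : ∀ b m → length (word b m) ≡ suc m
length-word b m = cong suc (List.length-applyUpTo (b ∘ suc) m)

letters-word : ∀ b m → Agree (length (word b m)) (letters (word b m)) b
letters-word b m = applyUpTo⇒⊑ (toList (word b m)) b {suc m} refl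

⊑⇒SubstringOfCF : ∀ x b r → toList x ⊑ b at r → x SubstringOfCF b
⊑⇒SubstringOfCF x b r e = r , ⊑⇒applyUpTo (toList x) (tail r b) e

SubstringOfCF⇒⊑ : ∀ x b → x SubstringOfCF b → ∃ λ r → toList x ⊑ b at r
SubstringOfCF⇒⊑ x b (r , e) = r , applyUpTo⇒⊑ (toList x) (tail r b) e

-- If [b₀ , …] returns to the vertex Vᵢ after a shortest loop
-- Vᵢ , … , Vᵢ₊ₘ₊₂, then the word (bᵢ₊₁ , … , bᵢ₊ₘ₊₁) is in Ô.
Ô-free⇒B≢0 : ∀ b n → ¬ (∃ λ x → x ∈ Ô × x SubstringOfCF tail n b) →
             ∀ d i → n ≤ i → B (tail i b) (suc d) ≢ 0ℤ
-- Strong induction on the length of the loop, for all starting indices at once, supplies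
-- minimality.
Ô-free⇒B≢0 b n free = <-rec _ nonzero
  where
  nonzero : ∀ d → (∀ {j} → j < d → ∀ i → n ≤ i → B (tail i b) (suc j) ≢ 0ℤ) →
            ∀ i → n ≤ i → B (tail i b) (suc d) ≢ 0ℤ
  nonzero zero    rec i n≤i ()
  nonzero (suc m) rec i n≤i e with p , refl ← ℕ.m≤n⇒∃[o]m+o≡n n≤i =
    free (w , Ôᶜ⇒Ô w (value , distinct) , ⊑⇒SubstringOfCF w (tail n b) (suc p) occurs)
    where
    i′ = n + p
    c = tail 1 (tail i′ b)
    w = word c m
    value : A (letters w) (length w) ≡ 0ℤ
    value = trans (A-cong (length w) (letters-word c m))
      (trans (cong (A c) (length-word c m)) (trans (sym (B-suc (tail i′ b) (suc m))) e))
    distinct : ∀ k j → k + suc j ≤ length w → B (tail k (letters w)) (suc j) ≢ 0ℤ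
    -- A repetition at offset `k` of `w` is a shorter loop; `suc k` appears because `w` begins one
    -- entry after `i′`.
    distinct k j le z = rec {j} (subst (suc j ≤_) (length-word c m) (ℕ.m+n≤o⇒n≤o k le))
      (i′ + suc k) (ℕ.≤-trans n≤i (ℕ.m≤m+n i′ (suc k)))
      (trans (B-cong (suc j) λ l l<j → trans (cong b (ℕ.+-assoc i′ (suc k) l))
        (sym (letters-word c m (k + l) (ℕ.<-≤-trans (ℕ.+-monoʳ-< k l<j) le)))) z)
    occurs : toList w ⊑ tail n b at suc p
    occurs l l<w = trans (letters-word c m l l<w)
      (cong b (trans (ℕ.+-assoc n p (suc l)) (cong (n ℕ.+_) (ℕ.+-suc p l))))

Ô-excludes : ExcludedMiddle 0ℓ → Diverges ⊆ Ex Ô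
Ô-excludes em {b} diverges n with em {∃ λ x → x ∈ Ô × x SubstringOfCF tail n b}
... | yes found = found
... | no  free  = ⊥-elim (diverges (converges em b n distinct))
  where
  distinct : ∀ {i j} → n ≤ i → i < j → A b i ℤ.* B b j ≢ A b j ℤ.* B b i
  distinct {i} n≤i i<j e with d , refl ← ℕ.m≤n⇒∃[o]m+o≡n i<j =
    Ô-free⇒B≢0 b n free d i n≤i (trans (sym (cross b i (suc d)))
      (trans (cong (λ k → A b i ℤ.* B b k ℤ.- A b k ℤ.* B b i) (ℕ.+-suc i d)) (ℤ.i≡j⇒i-j≡0 e)))

Ô-isExclusionSet : ExcludedMiddle 0ℓ → IsExclusionSet Ô
Ô-isExclusionSet em = record
  { symmetric         = Ô-symmetric
  ; withoutRedundancy = Ô-withoutRedundancy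
  ; excludes          = λ {b} → Ô-excludes em {b}
  }

-- Nested substrings and periodic weaves.

Substring-⊑ : ∀ x y {b r} → y SubstringOf x → toList x ⊑ b at r → ∃ λ s → toList y ⊑ b at (r + s)
Substring-⊑ x y {b} {r} inf e with s , e′ , le ← infix⇒⊑ inf =
  s , λ i i<y → trans (e′ i i<y)
    (trans (e (s + i) (ℕ.<-≤-trans (ℕ.+-monoʳ-< s i<y) le)) (cong b (sym (ℕ.+-assoc r s i))))

Substring-SubstringOfCF : ∀ x y {b} → y SubstringOf x → x SubstringOfCF b → y SubstringOfCF b
Substring-SubstringOfCF x y {b} inf sub
  with r , e ← SubstringOfCF⇒⊑ x b sub
  with s , e′ ← Substring-⊑ x y {b} {r} inf e = ⊑⇒SubstringOfCF y b (r + s) e′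

-- weave c w t r is r , c t , w , c (not t) , w , c t , w , ….
weave : (Bool → ℤ) → List ℤ → Bool → List ℤ → CF
weave c w t []      zero    = c t
weave c w t []      (suc n) = weave c w (not t) w n
weave c w t (x ∷ r) zero    = x
weave c w t (x ∷ r) (suc n) = weave c w t r n

module _ (c : Bool → ℤ) (w : List ℤ) where

  -- Each step drops a letter of the remainder or restarts it as `w`. The invariant `P` is later
  -- instantiated with `Suffix` and `Remainder`.
  weave-tail : ∀ {P : Pred (List ℤ) 0ℓ} → P w → (∀ {x r} → P (x ∷ r) → P r) →
    ∀ n t {r} → P r → ∃ λ t′ → ∃ λ r′ → P r′ × ∀ i → weave c w t r (n + i) ≡ weave c w t′ r′ i
  weave-tail Pw step zero    t {r} Pr = t , r , Pr , λ _ → refl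
  weave-tail Pw step (suc n) t {[]}    Pr = weave-tail Pw step n (not t) Pw
  weave-tail Pw step (suc n) t {x ∷ r} Pr = weave-tail Pw step n t (step Pr)

  weave-prefix : ∀ t r → Agree (List.length r) (entry r) (weave c w t r)
  weave-prefix t (x ∷ r) zero    _       = refl
  weave-prefix t (x ∷ r) (suc i) (s≤s p) = weave-prefix t r i p

  weave-skip : ∀ t r i → weave c w t r (List.length r + i) ≡ weave c w t [] i
  weave-skip t []      i = refl
  weave-skip t (x ∷ r) i = weave-skip t r i

  Suffix : Pred (List ℤ) 0ℓ
  Suffix r = ∃ λ pre → pre ++ r ≡ w

  Suffix-step : ∀ {x r} → Suffix (x ∷ r) → Suffix r
  Suffix-step {x} {r} (pre , e) = pre List.∷ʳ x , trans (List.∷ʳ-++ pre x r) e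

  -- The occurrence starts in some suffix `s` of `w` and cannot run past its end, because the entry
  -- after `s` is a separator.
  weave-⊑⇒Infix : ∀ {t xs r} → xs ⊑ weave c w t [] at r →
    (∀ i → i < List.length xs → ∀ t → entry xs i ≢ c t) → Infix _≡_ xs w
  weave-⊑⇒Infix {t} {xs} {r} e avoid
    with weave-tail {Suffix} ([] , refl) Suffix-step r t {[]} (w , List.++-identityʳ w)
  ... | t′ , s , (pre , refl) , eq = pre ++ⁱ here (Agree⇒Prefix xs s
          (λ i i<xs → trans (e i i<xs) (trans (eq i)
            (sym (weave-prefix t′ s i (ℕ.<-≤-trans i<xs xs≤s))))) xs≤s)
    where
    xs≤s : List.length xs ≤ List.length s
    xs≤s = ℕ.≮⇒≥ λ s<xs → avoid (List.length s) s<xs t′ (trans (e _ s<xs) (trans (eq _)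
      (trans (cong (weave _ _ t′ s) (sym (ℕ.+-identityʳ _))) (weave-skip t′ s 0))))

  weave-⊒ : ∀ t n → ∃ λ r → w ⊑ tail n (weave c w t []) at r
  weave-⊒ t n with weave-tail {Suffix} ([] , refl) Suffix-step n t {[]} (w , List.++-identityʳ w)
  -- After the remainder `s` and one separator, a full copy of `w` begins.
  ... | t′ , s , _ , eq = List.length s + 1 , λ i i<w → sym (begin
    weave c w t [] (n + (List.length s + 1 + i)) ≡⟨ eq _ ⟩
    weave c w t′ s (List.length s + 1 + i)       ≡⟨
      cong (weave c w t′ s) (ℕ.+-assoc (List.length s) 1 i) ⟩
    weave c w t′ s (List.length s + suc i)       ≡⟨ weave-skip t′ s (suc i) ⟩
    weave c w (not t′) w i                       ≡⟨ weave-prefix (not t′) w i i<w ⟨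
    entry w i                                    ∎)
    where open ≡-Reasoning

-- Divergent periodic continued fractions through a word of `Ô`.

unit-pair : ∀ i j → i ℤ.* j ≡ 1ℤ → (i ≡ 1ℤ × j ≡ 1ℤ) ⊎ (i ≡ ℤ.- 1ℤ × j ≡ ℤ.- 1ℤ)
unit-pair i j e
  with ℕ.m*n≡1⇒m≡1 ∣ i ∣ ∣ j ∣ ∣ij∣≡1 | ℕ.m*n≡1⇒n≡1 ∣ i ∣ ∣ j ∣ ∣ij∣≡1
  where
  ∣ij∣≡1 : ∣ i ∣ ℕ.* ∣ j ∣ ≡ 1
  ∣ij∣≡1 = trans (sym (ℤ.abs-* i j)) (cong ∣_∣ e)
unit-pair (+ _)    (+ _)    e | refl | refl = inj₁ (refl , refl)
unit-pair -[1+ _ ] -[1+ _ ] e | refl | refl = inj₂ (refl , refl)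
unit-pair (+ _)    -[1+ _ ] () | refl | refl
unit-pair -[1+ _ ] (+ _)    () | refl | refl

-- Expansion in the solutions `A` and `B` of the tail; both sides start with `f 1` and
-- `b 1 * f 1 - f 0`.
Solves-split : ∀ {b f} → Solves b f → ∀ n →
  f (suc n) ≡ f 1 ℤ.* A (tail 1 b) n ℤ.- B (tail 1 b) n ℤ.* f 0
Solves-split {b} {f} sol = Solves-unique {tail 1 b} (Solves-tail {b} {f} 1 sol)
  (Solves-wronskian {tail 1 b} (A-solves (tail 1 b)) (B-solves (tail 1 b)) (f 1) (f 0))
  (l₁ (f 1) (f 0)) (trans (sol 0) (l₂ (b 1) (f 1) (f 0)))
  where
  l₁ : ∀ x y → x ≡ x ℤ.* 1ℤ ℤ.- 0ℤ ℤ.* y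
  l₁ = solve-∀
  l₂ : ∀ b x y → b ℤ.* x ℤ.- y ≡ x ℤ.* b ℤ.- 1ℤ ℤ.* y
  l₂ = solve-∀

Solves-cong : ∀ {b b′ f} → (∀ i → b i ≡ b′ i) → Solves b f → Solves b′ f
Solves-cong e sol n rewrite sym (e (suc n)) = sol n

periodic : ∀ {f : ℕ → ℤ} P → (∀ i → f (P + i) ≡ f i) → ∀ k i → f (k ℕ.* P + i) ≡ f i
periodic         P per zero    i = refl
periodic {f} P per (suc k) i =
  trans (cong f (ℕ.+-assoc P (k ℕ.* P) i)) (trans (per (k ℕ.* P + i)) (periodic {f} P per k i))

module Loop (w : Word) (w∈Ô : w ∈ Ô) where

  private
    n = length w
    m = List.length (List⁺.tail w)

  ε β : ℤ
  ε = A (letters w) m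
  β = B (letters w) m

  private
    δ = B (letters w) n

  -- The value of `w` is 0, so `A` vanishes at `n` and `det` reduces to `ε * δ` being 1.
  ε,δ : (ε ≡ 1ℤ × δ ≡ 1ℤ) ⊎ (ε ≡ ℤ.- 1ℤ × δ ≡ ℤ.- 1ℤ)
  ε,δ = unit-pair ε δ (trans
    (trans (lemma (ε ℤ.* δ) β)
      (cong (λ u → ε ℤ.* δ ℤ.- u ℤ.* β) (sym (proj₁ (Ô⇒Ôᶜ w w∈Ô)))))
    (det (letters w) m))
    where
    lemma : ∀ x y → x ≡ x ℤ.- 0ℤ ℤ.* y
    lemma = solve-∀

  module _ {b f} (agree : Agree n (letters w) (tail 1 b)) (sol : Solves b f) where

    -- The coefficient of `f 1` is the numerator of the value of `w`, hence 0.
    block₀ : f (suc n) ≡ ℤ.- (δ ℤ.* f 0)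
    block₀ = trans (Solves-split {b} sol n)
      (trans (cong₂ (λ u v → f 1 ℤ.* u ℤ.- v ℤ.* f 0)
        (trans (sym (A-cong n agree)) (proj₁ (Ô⇒Ôᶜ w w∈Ô))) (sym (B-cong n agree)))
        (lemma (f 1) (δ ℤ.* f 0)))
      where
      lemma : ∀ x y → x ℤ.* 0ℤ ℤ.- y ≡ ℤ.- y
      lemma = solve-∀

    block₋₁ : f n ≡ f 1 ℤ.* ε ℤ.- β ℤ.* f 0
    block₋₁ = trans (Solves-split {b} sol m)
      (sym (cong₂ (λ u v → f 1 ℤ.* u ℤ.- v ℤ.* f 0)
        (A-cong m (Agree-pred agree)) (B-cong m (Agree-pred agree))))

    block₁ : f (suc (suc n)) ≡ b (suc n) ℤ.* ℤ.- (δ ℤ.* f 0) ℤ.- (f 1 ℤ.* ε ℤ.- β ℤ.* f 0)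
    block₁ = trans (sol n) (cong₂ (λ u v → b (suc n) ℤ.* u ℤ.- v) block₀ block₋₁)

  -- The product of the matrices of w is ± (0, -1; 1, ·), so that c t , w
  -- acts as a translation; these separators make the two translations cancel.
  shift : ℤ
  shift = + 2 ℤ.* (ε ℤ.* β)

  module _ (x : ℤ) where

    separator : Bool → ℤ
    separator true  = x
    separator false = shift ℤ.- x

    private
      D : Bool → CF
      D t = weave separator (toList w) t []
      N = suc n

    D-tail : ∀ t i → D t (N + i) ≡ D (not t) i
    D-tail t i = weave-skip separator (toList w) (not t) (toList w) i

    D-agree : ∀ t → Agree n (letters w) (tail 1 (D t))
    D-agree t = weave-prefix separator (toList w) (not t) (toList w)

    D-next : ∀ t → D t N ≡ separator (not t)
    D-next t = trans (cong (D t) (sym (ℕ.+-identityʳ N))) (D-tail t 0)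

    -- Each round multiplies the value at index 0 by `- δ`, whose square is 1. At index 1, two
    -- rounds leave `f 1` plus `f 0` times the sum of the separators minus `2 * (ε * β)`, which
    -- `shift` makes vanish.
    solution-period : ∀ {f} → Solves (D true) f → ∀ i → f (N + (N + i)) ≡ f i
    solution-period {f} sol = Solves-unique {D true} sol″ sol start₀ start₁
      where
      f′ = λ i → f (N + i)
      sol′ : Solves (D false) f′
      sol′ = Solves-cong (D-tail true) (Solves-tail {D true} N sol)
      sol″ : Solves (D true) (λ i → f (N + (N + i)))
      sol″ = Solves-cong (D-tail false) (Solves-tail {D false} N sol′)
      f′0 : f′ 0 ≡ ℤ.- (δ ℤ.* f 0)
      f′0 = trans (cong f (ℕ.+-identityʳ N)) (block₀ {D true} (D-agree true) sol)
      f′1 : f′ 1 ≡ separator false ℤ.* ℤ.- (δ ℤ.* f 0) ℤ.- (f 1 ℤ.* ε ℤ.- β ℤ.* f 0)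
      f′1 = trans (cong f (ℕ.+-comm N 1)) (trans (block₁ {D true} (D-agree true) sol)
        (cong (λ u → u ℤ.* ℤ.- (δ ℤ.* f 0) ℤ.- (f 1 ℤ.* ε ℤ.- β ℤ.* f 0)) (D-next true)))
      start₀ : f (N + (N + 0)) ≡ f 0
      start₀ = trans (cong f′ (ℕ.+-identityʳ N)) (trans (block₀ {D false} (D-agree false) sol′)
        (trans (cong (λ u → ℤ.- (δ ℤ.* u)) f′0) (sign ε,δ)))
        where
        l₊ : ∀ x → ℤ.- (1ℤ ℤ.* ℤ.- (1ℤ ℤ.* x)) ≡ x
        l₊ = solve-∀
        l₋ : ∀ x → ℤ.- (ℤ.- 1ℤ ℤ.* ℤ.- (ℤ.- 1ℤ ℤ.* x)) ≡ x
        l₋ = solve-∀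
        sign : (ε ≡ 1ℤ × δ ≡ 1ℤ) ⊎ (ε ≡ ℤ.- 1ℤ × δ ≡ ℤ.- 1ℤ) → ℤ.- (δ ℤ.* ℤ.- (δ ℤ.* f 0)) ≡ f 0
        sign (inj₁ (_ , e)) rewrite e = l₊ (f 0)
        sign (inj₂ (_ , e)) rewrite e = l₋ (f 0)
      start₁ : f (N + (N + 1)) ≡ f 1
      start₁ = trans (cong f′ (ℕ.+-comm N 1)) (trans (block₁ {D false} (D-agree false) sol′)
        (trans (cong (λ u → u ℤ.* ℤ.- (δ ℤ.* f′ 0) ℤ.- (f′ 1 ℤ.* ε ℤ.- β ℤ.* f′ 0)) (D-next false))
        (trans (cong₂ (λ u v → x ℤ.* ℤ.- (δ ℤ.* u) ℤ.- (v ℤ.* ε ℤ.- β ℤ.* u)) f′0 f′1)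
          (ring ε,δ (f 0) (f 1)))))
        where
        Goal : ℤ → ℤ → ℤ → ℤ → ℤ → ℤ → Set
        Goal ε δ β x f₀ f₁ =
          x ℤ.* ℤ.- (δ ℤ.* ℤ.- (δ ℤ.* f₀)) ℤ.-
          (((+ 2 ℤ.* (ε ℤ.* β) ℤ.- x) ℤ.* ℤ.- (δ ℤ.* f₀) ℤ.- (f₁ ℤ.* ε ℤ.- β ℤ.* f₀)) ℤ.* ε
           ℤ.- β ℤ.* ℤ.- (δ ℤ.* f₀)) ≡ f₁
        l₊ : ∀ β x f₀ f₁ →
          x ℤ.* ℤ.- (1ℤ ℤ.* ℤ.- (1ℤ ℤ.* f₀)) ℤ.-
          (((+ 2 ℤ.* (1ℤ ℤ.* β) ℤ.- x) ℤ.* ℤ.- (1ℤ ℤ.* f₀) ℤ.- (f₁ ℤ.* 1ℤ ℤ.- β ℤ.* f₀))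
           ℤ.* 1ℤ
           ℤ.- β ℤ.* ℤ.- (1ℤ ℤ.* f₀)) ≡ f₁
        l₊ = solve-∀
        l₋ : ∀ β x f₀ f₁ →
          x ℤ.* ℤ.- (ℤ.- 1ℤ ℤ.* ℤ.- (ℤ.- 1ℤ ℤ.* f₀)) ℤ.-
          (((+ 2 ℤ.* (ℤ.- 1ℤ ℤ.* β) ℤ.- x) ℤ.* ℤ.- (ℤ.- 1ℤ ℤ.* f₀) ℤ.- (f₁ ℤ.* ℤ.- 1ℤ ℤ.- β ℤ.* f₀))
           ℤ.* ℤ.- 1ℤ
           ℤ.- β ℤ.* ℤ.- (ℤ.- 1ℤ ℤ.* f₀)) ≡ f₁
        l₋ = solve-∀
        ring : ∀ {ε δ} → (ε ≡ 1ℤ × δ ≡ 1ℤ) ⊎ (ε ≡ ℤ.- 1ℤ × δ ≡ ℤ.- 1ℤ) → ∀ f₀ f₁ → Goal ε δ β x f₀ f₁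
        ring (inj₁ (refl , refl)) = l₊ β x
        ring (inj₂ (refl , refl)) = l₋ β x

  loop : ℕ → CF
  loop k = weave (separator (+ k)) (toList w) true []

  loop-diverges : ∀ k → Diverges (loop k)
  loop-diverges k (z , conv) = contradict z conv
    where
    D = loop k
    P = suc n + suc n
    period : ∀ {f} → Solves D f → ∀ j i → f (j ℕ.* P + i) ≡ f i
    period {f} sol = periodic {f} P λ i →
      trans (cong f (ℕ.+-assoc (suc n) (suc n) i)) (solution-period (+ k) sol i)
    recurs : ∀ j i → convergent D (j ℕ.* P + i) ≡ convergent D i
    recurs j i = cong₂ _÷_ (period (A-solves D) j i) (period (B-solves D) j i)
    later : ∀ j i → j ≤ j ℕ.* P + i
    later j i = ℕ.≤-trans (ℕ.m≤m*n j P) (ℕ.m≤m+n (j ℕ.* P) i)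
    -- The convergent of index 1, since `loop k` begins with `k`; it lies in the closed square that
    -- `exterior q` omits.
    q = + k ℚ./ 1
    0≤q : 0ℚ ℚ.≤ q
    0≤q = ℚ.nonNegative⁻¹ q {{ℚ.normalize-nonNeg k 1}}
    -q≤0 : ℚ.- q ℚ.≤ 0ℚ
    -q≤0 = ℚ.neg-antimono-≤ 0≤q
    outside : ¬ (ι (fin q) ∈ᵒ exterior q)
    outside (inj₁ (inj₁ p)) = ℚ.<-irrefl refl (ℚ.<-≤-trans p (ℚ.≤-trans -q≤0 0≤q))
    outside (inj₁ (inj₂ p)) = ℚ.<-irrefl refl p
    outside (inj₂ (inj₁ p)) = ℚ.<-irrefl refl (ℚ.<-≤-trans p -q≤0)
    outside (inj₂ (inj₂ p)) = ℚ.<-irrefl refl (ℚ.<-≤-trans p 0≤q)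
    contradict : ∀ z → ¬ ((λ i → ι (convergent D i)) ⟶ z)
    contradict ∞ conv with J , eventually ← conv (exterior q) _ =
      outside (subst (λ v → ι v ∈ᵒ exterior q) (recurs J 1) (eventually _ (later J 1)))
    -- The convergent of index 0 is ∞, and it recurs outside every rectangle.
    contradict (x +i y) conv
      with (p , p<x) , (q′ , x<q) ← ℝ.inhabited x | (r , r<y) , (s , y<s) ← ℝ.inhabited y
      with J , eventually ← conv (rectangle p q′ r s) ((p<x , x<q) , (r<y , y<s)) =
      subst (λ v → ι v ∈ᵒ rectangle p q′ r s) (recurs J 0) (eventually _ (later J 0))

-- Exclusion sets with bounded letters.

Bounds : ℕ → Word → Set
Bounds M x = ∀ i → ∣ letters x i ∣ < M

entry-bound : ∀ xs → ∃ λ M → ∀ i → ∣ entry xs i ∣ < M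
-- The padding zeros also have to lie strictly below the bound.
entry-bound []       = 1 , λ _ → s≤s z≤n
entry-bound (x ∷ xs) with M , p ← entry-bound xs = suc ∣ x ∣ ⊔ M , λ where
  zero    → ℕ.m≤m⊔n (suc ∣ x ∣) M
  (suc i) → ℕ.≤-trans (p i) (ℕ.m≤n⊔m (suc ∣ x ∣) M)

bound : ∀ (ws : List Word) → ∃ λ M → ∀ {x} → x List.∈ ws → Bounds M x
bound []       = 0 , λ ()
bound (w ∷ ws) with K , p ← entry-bound (toList w) | M , q ← bound ws = K ⊔ M , λ where
  (here refl) i → ℕ.≤-trans (p i) (ℕ.m≤m⊔n K M)
  (there x∈) i  → ℕ.≤-trans (q x∈ i) (ℕ.m≤n⊔m K M)

module _ {O : Pred Word 0ℓ} (exclusion : IsExclusionSet O)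
         {M} (bounds : ∀ {x} → x ∈ O → Bounds M x) where

  Ô-contains : ∀ w → w ∈ Ô → ∃ λ x → x ∈ O × x SubstringOf w
  Ô-contains w w∈Ô
    with x , x∈O , sub ← IsExclusionSet.excludes exclusion
      (Loop.loop-diverges w w∈Ô (M + ∣ Loop.shift w w∈Ô ∣)) 0
    with r , e ← SubstringOfCF⇒⊑ x (Loop.loop w w∈Ô (M + ∣ Loop.shift w w∈Ô ∣)) sub =
    x , x∈O , weave-⊑⇒Infix (separator K) (toList w) {true} {toList x} {r} e
      (λ i _ t eq → ℕ.<⇒≱ (bounds x∈O i) (subst (λ u → M ≤ ∣ u ∣) (sym eq) (large t)))
    where
    open Loop w w∈Ô
    -- Large enough that `shift - K` too has absolute value at least `M`.
    K = + (M + ∣ shift ∣)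
    large : ∀ t → M ≤ ∣ separator K t ∣
    large true  = ℕ.m≤m+n M ∣ shift ∣
    large false = ℕ.+-cancelʳ-≤ ∣ shift ∣ M _ (begin
      ∣ K ∣                               ≡⟨ cong ∣_∣ (lemma K shift) ⟩
      ∣ ℤ.- (shift ℤ.- K) ℤ.+ shift ∣     ≤⟨ ℤ.∣i+j∣≤∣i∣+∣j∣ (ℤ.- (shift ℤ.- K)) shift ⟩
      ∣ ℤ.- (shift ℤ.- K) ∣ + ∣ shift ∣   ≡⟨ cong (_+ ∣ shift ∣) (ℤ.∣-i∣≡∣i∣ (shift ℤ.- K)) ⟩
      ∣ shift ℤ.- K ∣ + ∣ shift ∣         ∎)
      where
      open ℕ.≤-Reasoning
      lemma : ∀ k s → k ≡ ℤ.- (s ℤ.- k) ℤ.+ s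
      lemma = solve-∀

  Ex-Ô⊆Ex : Ex Ô ⊆ Ex O
  Ex-Ô⊆Ex {b} ex n
    with w , w∈Ô , sub ← ex n
    with x , x∈O , inf ← Ô-contains w w∈Ô =
    x , x∈O , Substring-SubstringOfCF w x {tail n b} inf sub

-- Positive solutions of the recurrence.

product-positive : ∀ {i j} → 0ℤ ℤ.< i → 0ℤ ℤ.< j → 0ℤ ℤ.< i ℤ.* j
product-positive {i} {j} 0<i 0<j =
  subst (ℤ._< i ℤ.* j) (ℤ.*-zeroʳ i) (ℤ.*-monoˡ-<-pos i {{ℤ.positive 0<i}} 0<j)

wronskian-positive : ∀ {p q x y z} → p ℤ.* x ℤ.- q ℤ.* y ≡ z →
  0ℤ ℤ.< p → 0ℤ ℤ.< q → 0ℤ ℤ.< y → 0ℤ ℤ.< z → 0ℤ ℤ.< x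
wronskian-positive {p} {q} {x} {y} {z} e 0<p 0<q 0<y 0<z =
  ℤ.*-cancelˡ-<-nonNeg {0ℤ} {x} p {{ℤ.nonNegative (ℤ.<⇒≤ 0<p)}}
    (subst₂ ℤ._<_ (sym (ℤ.*-zeroʳ p))
      (trans (cong (ℤ._+ q ℤ.* y) (sym e)) (lemma (p ℤ.* x) (q ℤ.* y)))
      (ℤ.+-mono-<-≤ 0<z (ℤ.<⇒≤ (product-positive {q} {y} 0<q 0<y))))
  where
  lemma : ∀ u v → u ℤ.- v ℤ.+ v ≡ u
  lemma = solve-∀

-- A discrete Sturm comparison: the Wronskian of `h` and `B b` is the constant `h 0`, so positivity
-- of `B b` passes from each index to the next.
Solves-positive : ∀ {b h} → Solves b h → (∀ n → 0ℤ ℤ.< h n) → ∀ n → 0ℤ ℤ.< B b (suc n)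
Solves-positive {b} {h} sol pos zero    = ℤ.+<+ (s≤s z≤n)
Solves-positive {b} {h} sol pos (suc n) =
  wronskian-positive {h (suc n)} {h (suc (suc n))} {B b (suc (suc n))} {B b (suc n)}
    (trans (wronskian-constant {b} {h} {B b} sol (B-solves b) (suc n)) (lemma (h 0) (h 1)))
    (pos (suc n)) (pos (suc (suc n))) (Solves-positive {b} {h} sol pos n) (pos 0)
  where
  lemma : ∀ x y → x ℤ.* 1ℤ ℤ.- y ℤ.* 0ℤ ≡ x
  lemma = solve-∀

B-positive⇒∉Ex-Ô : ∀ b → (∀ i n → 0ℤ ℤ.< B (tail i b) (suc n)) → ¬ Ex Ô b
B-positive⇒∉Ex-Ô b pos ex
  -- Starting at `tail 1 b` leaves an entry in front of the word, as `B-suc` requires.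
  with x , x∈Ô , sub ← ex 1
  with r , e ← SubstringOfCF⇒⊑ x (tail 1 b) sub = ℤ.<-irrefl (sym (begin
    B (tail r b) (suc (length x))        ≡⟨ B-suc (tail r b) (length x) ⟩
    A (tail 1 (tail r b)) (length x)     ≡⟨ A-cong (length x) (λ i i<x →
      trans (e i i<x) (cong b (sym (ℕ.+-suc r i)))) ⟨
    A (letters x) (length x)             ≡⟨ proj₁ (Ô⇒Ôᶜ x x∈Ô) ⟩
    0ℤ                                   ∎)) (pos r (length x))
  where open ≡-Reasoning

-- Fans, and a continued fraction outside `Ex Ô`.

module _ (m : ℕ) where

  block : Word
  block = 1ℤ ∷⁺ replicate m (+ 2)

  private
    v : List ℤ
    v = toList block

  -- The vertices of its path are ∞, m + 1, m, …, 0.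
  fan : Word
  fan = + suc m ∷⁺ v

  private
    -- Continues `fan` by twos instead of zeros, so that the closed forms of `A` and `B` hold at all
    -- later indices.
    fanCF : CF
    fanCF zero          = + suc m
    fanCF (suc zero)    = 1ℤ
    fanCF (suc (suc i)) = + 2

    fan-agree : Agree (length fan) (letters fan) fanCF
    fan-agree zero          _               = refl
    fan-agree (suc zero)    _               = refl
    fan-agree (suc (suc i)) (s≤s (s≤s i<l)) = twos m i i<l
      where
      twos : ∀ k i → i < List.length (replicate k (+ 2)) → entry (replicate k (+ 2)) i ≡ + 2
      twos (suc k) zero    _       = refl
      twos (suc k) (suc i) (s≤s p) = twos k i p

    length-fan : length fan ≡ suc (suc m)
    length-fan = cong (suc ∘ suc) (List.length-replicate m)

    fan-A : ∀ k → A fanCF (suc k) ≡ + suc m ℤ.- + k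
    fan-A = Solves-unique {tail 1 fanCF} (λ _ → refl) (λ k → l₀ (+ suc m) (+ k))
      (l₁ (+ suc m)) (l₂ (+ suc m))
      where
      l₀ : ∀ x k → x ℤ.- (+ 2 ℤ.+ k) ≡ + 2 ℤ.* (x ℤ.- (1ℤ ℤ.+ k)) ℤ.- (x ℤ.- k)
      l₀ = solve-∀
      l₁ : ∀ x → x ≡ x ℤ.- 0ℤ
      l₁ = solve-∀
      l₂ : ∀ x → 1ℤ ℤ.* x ℤ.- 1ℤ ≡ x ℤ.- 1ℤ
      l₂ = solve-∀

    fan-B : ∀ k → B fanCF (suc k) ≡ 1ℤ
    fan-B = Solves-unique {tail 1 fanCF} (λ _ → refl) (λ _ → refl) refl refl

    -- From index 1 on the vertices are integers descending by 1, and `cross` gives their distance.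
    fan-B-tail : ∀ i j → B (tail i fanCF) (suc j) ≢ 0ℤ
    fan-B-tail zero    j e with () ← trans (sym (fan-B j)) e
    fan-B-tail (suc i) j e = absurd (trans (sym value) e)
      where
      lemma : ∀ x i j → (x ℤ.- i) ℤ.* 1ℤ ℤ.- (x ℤ.- (i ℤ.+ j)) ℤ.* 1ℤ ≡ j
      lemma = solve-∀
      absurd : + suc j ≢ 0ℤ
      absurd ()
      value : B (tail (suc i) fanCF) (suc j) ≡ + suc j
      value = trans (sym (cross fanCF (suc i) (suc j)))
        (trans (cong₂ ℤ._-_ (cong₂ ℤ._*_ (fan-A i) (fan-B (i + suc j)))
                            (cong₂ ℤ._*_ (fan-A (i + suc j)) (fan-B i)))
          (lemma (+ suc m) (+ i) (+ suc j)))

  fan∈Ô : fan ∈ Ô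
  fan∈Ô = Ôᶜ⇒Ô fan
    ( trans (A-cong (length fan) fan-agree) (trans (cong (A fanCF) length-fan)
        (trans (fan-A (suc m)) (ℤ.+-inverseʳ (+ suc m))))
    , λ i j le e → fan-B-tail i j (trans (sym (B-cong (suc j)
        λ k k<j → fan-agree (i + k) (ℕ.<-≤-trans (ℕ.+-monoʳ-< i k<j) le))) e))

  private
    c : Bool → ℤ
    c _ = + (4 + m)

  simple : CF
  simple = weave c v true []

  -- A solution is linear along the twos; the entries 1 and m + 4 are those
  -- that let it rise from 1 to m + 2 and fall back to 1 forever.
  height : List ℤ → ℕ → ℤ
  height r       zero    = + suc (List.length r)
  height []      (suc n) = height v n
  height (_ ∷ r) (suc n) = height r n

  height-positive : ∀ r n → 0ℤ ℤ.< height r n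
  height-positive r       zero    = ℤ.+<+ (s≤s z≤n)
  height-positive []      (suc n) = height-positive v n
  height-positive (_ ∷ r) (suc n) = height-positive r n

  data Remainder : List ℤ → Set where
    full : Remainder v
    twos : ∀ {r} → All (_≡ + 2) r → Remainder r

  Remainder-step : ∀ {x r} → Remainder (x ∷ r) → Remainder r
  Remainder-step full           = twos (All.replicate⁺ m refl)
  Remainder-step (twos (_ ∷ rs)) = twos rs

  -- The cases at index 0 differ in the middle one of three positions: a two, the 1 after a
  -- separator, or a separator.
  height-solves : ∀ t {r} → Remainder r → Solves (weave c v t r) (height r)
  height-solves t {[]}    _   (suc n) = height-solves (not t) full n
  height-solves t {x ∷ r} rem (suc n) = height-solves t (Remainder-step rem) n
  height-solves t full zero = second m refl
    where
    l : ∀ x → x ≡ + 2 ℤ.* (1ℤ ℤ.+ x) ℤ.- (+ 2 ℤ.+ x)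
    l = solve-∀
    -- The copy `k` of the parameter `m` permits a case split; without twos, a separator already
    -- follows the 1.
    second : ∀ k → k ≡ m → height v 2 ≡ weave c v t v 1 ℤ.* height v 1 ℤ.- height v 0
    second zero refl = refl
    second (suc k) refl = l (+ suc (List.length (replicate k (+ 2))))
  height-solves t (twos []) zero = l (+ List.length (replicate m (+ 2)))
    where
    l : ∀ x → 1ℤ ℤ.+ x ≡ 1ℤ ℤ.* (+ 2 ℤ.+ x) ℤ.- 1ℤ
    l = solve-∀
  height-solves t (twos (refl ∷ [])) zero rewrite List.length-replicate m {x = + 2} = l (+ m)
    where
    l : ∀ x → + 2 ℤ.+ x ≡ (+ 4 ℤ.+ x) ℤ.* 1ℤ ℤ.- + 2
    l = solve-∀
  height-solves t (twos {_ ∷ _ ∷ r} (refl ∷ refl ∷ _)) zero = l (+ List.length r)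
    where
    l : ∀ x → 1ℤ ℤ.+ x ≡ + 2 ℤ.* (+ 2 ℤ.+ x) ℤ.- (+ 3 ℤ.+ x)
    l = solve-∀

  simple-positive : ∀ i n → 0ℤ ℤ.< B (tail i simple) (suc n)
  simple-positive i n
    with t , r , rem , e ← weave-tail c v {Remainder} full Remainder-step i true {[]} (twos []) =
    subst (0ℤ ℤ.<_) (sym (B-cong {tail i simple} {weave c v t r} (suc n) λ k _ → e k))
      (Solves-positive {weave c v t r} {height r} (height-solves t rem) (height-positive r) n)

  simple∉Ex-Ô : ¬ Ex Ô simple
  simple∉Ex-Ô = B-positive⇒∉Ex-Ô simple simple-positive

  block-recurs : ∀ n → block SubstringOfCF tail n simple
  block-recurs n =
    let r , e = weave-⊒ c v true n in ⊑⇒SubstringOfCF block (tail n simple) r e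

-- Strictness of the inclusion.

-- The letter `m + 1` exceeds all letters of `x`, so no occurrence starts there.
Infix-drop : ∀ {m ys} x → Bounds m x → Infix _≡_ (toList x) (+ suc m ∷ ys) → Infix _≡_ (toList x) ys
Infix-drop (_ ∷⁺ _) bounds (here (refl ∷ _)) = ⊥-elim (ℕ.<⇒≱ (bounds 0) (ℕ.n≤1+n _))
Infix-drop _        bounds (there inf)       = inf

-- The letter bound `m` also serves as the number of twos, which makes the first letter of `fan m`
-- too large for `O`.
Ex-simple : ∀ {O m} → IsExclusionSet O → (∀ {x} → x ∈ O → Bounds m x) → Ex O (simple m)
Ex-simple {O} {m} exclusion bounds n =
  let x , x∈O , inf = Ô-contains {O} exclusion {m} bounds (fan m) (fan∈Ô m)
  in x , x∈O , Substring-SubstringOfCF (block m) x {tail n (simple m)}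
       (Infix-drop {m} {toList (block m)} x (bounds x∈O) inf) (block-recurs m n)

Ex-Ô⊂Ex : ∀ {O m} → IsExclusionSet O → (∀ {x} → x ∈ O → Bounds m x) → Ex Ô ⊂ Ex O
Ex-Ô⊂Ex {O} {m} exclusion bounds =
  (λ {b} → Ex-Ô⊆Ex {O} exclusion {m} bounds {b}) ,
  λ Ex-O⊆Ex-Ô → simple∉Ex-Ô m (Ex-O⊆Ex-Ô {simple m} (Ex-simple {O} {m} exclusion bounds))

theoremB : ExcludedMiddle 0ℓ →
    IsExclusionSet Ô ×
    (∀ (O : Pred Word 0ℓ) → IsExclusionSet O → Finite O → Ex Ô ⊂ Ex O)
theoremB em = Ô-isExclusionSet em , λ O exclusion (ws , O⊆ws , _) →
  Ex-Ô⊂Ex {O} {proj₁ (bound ws)} exclusion (λ x∈O → proj₂ (bound ws) (O⊆ws x∈O))
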